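{- Let $G$ be an ordered abelian group and $H \subsetneq G$ a convex subgroup. Suppose that for every integer $n \geq 2$ the quotient $G/H$ has a non-trivial $n$-divisible convex subgroup and at least one of the following holds: (a) $v_G(H\setminus\{0\})$ has a minimum, or (b) there is a convex subgroup $H' \subsetneq H$ such that $H/H'$ is $n$-divisible. Then $H$ is not $\mathcal{L}_{\mathrm{og}}$-definable in $G$.
   Context: All orderings are linear. $\mathcal{L}_{\mathrm{og}}=\{+,-,0,<\}$ is the language of ordered groups, and "definable" means first-order definable with parameters from the structure. Two elements $a,b \in G$ are archimedean equivalent, $a\sim b$, if there is $n\in\mathbb{N}=\{1,2,\dots\}$ with $|a|\le n|b|$ and $|b|\le n|a|$; $[a]_+$ denotes the equivalence class of $a$. The set of classes is ordered by $[a]_+<[b]_+ :\Leftrightarrow |a|>|b|$ and $a\not\sim b$. The natural valuation on $G$ is $v_G\colon a\mapsto [a]_+$. Quotients by convex subgroups carry the induced ordering. -}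

module Defs where

open import Level using (Level; _⊔_; suc)
open import Algebra.Core using (Op₁; Op₂)
open import Algebra.Bundles using (AbelianGroup)
open import Algebra.Structures using (IsAbelianGroup)
open import Data.Fin.Base using (Fin)
open import Data.Nat.Base as ℕ using (ℕ)
open import Data.Product using (Σ; Σ-syntax; ∃-syntax; _×_; _,_; proj₁; proj₂)
open import Data.Sum.Base as Sum using (_⊎_; inj₁; inj₂)
open import Data.Vec.Base using (Vec; _∷_; lookup)
open import Function.Base using (_on_)
open import Function.Bundles using (_⇔_)
open import Relation.Binary.Bundles using (TotalOrder)
open import Relation.Binary.Core using (Rel)
open import Relation.Binary.Structures using (IsTotalOrder)
open import Relation.Nullary.Negation.Core using (¬_)
open import Relation.Unary using (Pred)
import Algebra.Construct.NaturalChoice.Max as Max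
import Algebra.Definitions.RawMonoid as RawMonoidDefinitions
import Algebra.Properties.AbelianGroup as AbelianGroupProperties
import Algebra.Properties.Group as GroupProperties
import Algebra.Properties.CommutativeSemigroup as CommutativeSemigroupProperties
import Relation.Binary.Construct.NonStrictToStrict as NonStrictToStrict
import Relation.Binary.Reasoning.Setoid as SetoidReasoning

record OrderedAbelianGroup c ℓ₁ ℓ₂ : Set (suc (c ⊔ ℓ₁ ⊔ ℓ₂)) where
  infix  8 -_
  infixl 6 _+_
  infix  4 _≈_ _≤_
  field
    Carrier        : Set c
    _≈_            : Rel Carrier ℓ₁
    _≤_            : Rel Carrier ℓ₂
    _+_            : Op₂ Carrier
    0#             : Carrier
    -_             : Op₁ Carrier
    isAbelianGroup : IsAbelianGroup _≈_ _+_ 0# -_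
    isTotalOrder   : IsTotalOrder _≈_ _≤_
    +-monoˡ-≤      : ∀ {x y} z → x ≤ y → x + z ≤ y + z

  abelianGroup : AbelianGroup c ℓ₁
  abelianGroup = record { isAbelianGroup = isAbelianGroup }

  totalOrder : TotalOrder c ℓ₁ ℓ₂
  totalOrder = record { isTotalOrder = isTotalOrder }

  open AbelianGroup abelianGroup public
    using (setoid; rawMonoid; monoid; group; commutativeSemigroup; refl; sym; trans; reflexive)
    renaming ( ∙-cong to +-cong; ∙-congˡ to +-congˡ; ∙-congʳ to +-congʳ
             ; assoc to +-assoc; comm to +-comm
             ; identityˡ to +-identityˡ; identityʳ to +-identityʳ
             ; inverseˡ to -‿inverseˡ; inverseʳ to -‿inverseʳ; ⁻¹-cong to -‿cong )

  open TotalOrder totalOrder public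
    using (total; antisym; ≤-respˡ-≈; ≤-respʳ-≈)
    renaming (refl to ≤-refl; reflexive to ≤-reflexive; trans to ≤-trans)

  open NonStrictToStrict _≈_ _≤_ public using (_<_)

  infix 4 _≉_
  _≉_ : Rel Carrier ℓ₁
  x ≉ y = ¬ (x ≈ y)

  infixr 8 _·_
  _·_ : ℕ → Carrier → Carrier
  _·_ = RawMonoidDefinitions._×_ rawMonoid

  ∣_∣ : Op₁ Carrier
  ∣ x ∣ = Max._⊔_ totalOrder x (- x)

module _ {c ℓ₁ ℓ₂} (G : OrderedAbelianGroup c ℓ₁ ℓ₂) where
  open OrderedAbelianGroup G

  NonTrivial : Set (c ⊔ ℓ₁)
  NonTrivial = ∃[ x ] x ≉ 0#

  Divisible : ℕ → Set (c ⊔ ℓ₁)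
  Divisible n = ∀ x → ∃[ y ] n · y ≈ x

-- Closure under _≈_ is a consequence of convexity; see `resp` below.

  record ConvexSubgroup h : Set (c ⊔ ℓ₂ ⊔ suc h) where
    infix 4 _∈H
    field
      _∈H       : Pred Carrier h
      0∈        : 0# ∈H
      +-closed  : ∀ {x y} → x ∈H → y ∈H → x + y ∈H
      -‿closed  : ∀ {x} → x ∈H → - x ∈H
      convex    : ∀ {x y z} → x ∈H → z ∈H → x ≤ y → y ≤ z → y ∈H

    resp : ∀ {x y} → x ≈ y → x ∈H → y ∈H
    resp x≈y x∈ = convex x∈ x∈ (≤-reflexive x≈y) (≤-reflexive (sym x≈y))

  Proper : ∀ {h} → ConvexSubgroup h → Set (c ⊔ h)
  Proper H = ∃[ x ] ¬ (x ∈H)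
    where open ConvexSubgroup H

module _ {c ℓ₁ ℓ₂ h} (G : OrderedAbelianGroup c ℓ₁ ℓ₂) (H : ConvexSubgroup G h) where
  open OrderedAbelianGroup G
  open ConvexSubgroup H
  open GroupProperties group using () renaming (ε⁻¹≈ε to -0≈0; ⁻¹-involutive to -‿involutive)
  open AbelianGroupProperties abelianGroup using () renaming (⁻¹-∙-comm to -‿+-comm)
  open CommutativeSemigroupProperties commutativeSemigroup using (interchange)
  open SetoidReasoning setoid

  subgroup : OrderedAbelianGroup (c ⊔ h) ℓ₁ ℓ₂
  subgroup = record
    { Carrier        = Σ Carrier _∈H
    ; _≈_            = _≈_ on proj₁
    ; _≤_            = _≤_ on proj₁
    ; _+_            = λ (x , x∈) (y , y∈) → x + y , +-closed x∈ y∈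
    ; 0#             = 0# , 0∈
    ; -_             = λ (x , x∈) → - x , -‿closed x∈
    ; isAbelianGroup = record
      { isGroup = record
        { isMonoid = record
          { isSemigroup = record
            { isMagma = record
              { isEquivalence = record { refl = refl ; sym = sym ; trans = trans }
              ; ∙-cong        = +-cong
              }
            ; assoc = λ _ _ _ → +-assoc _ _ _
            }
          ; identity = (λ _ → +-identityˡ _) , (λ _ → +-identityʳ _)
          }
        ; inverse = (λ _ → -‿inverseˡ _) , (λ _ → -‿inverseʳ _)
        ; ⁻¹-cong = -‿cong
        }
      ; comm = λ _ _ → +-comm _ _
      }
    ; isTotalOrder   = record
      { isPartialOrder = record
        { isPreorder = record
          { isEquivalence = record { refl = refl ; sym = sym ; trans = trans }
          ; reflexive     = ≤-reflexive
          ; trans         = ≤-trans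
          }
        ; antisym = antisym
        }
      ; total = λ _ _ → total _ _
      }
    ; +-monoˡ-≤      = λ _ → +-monoˡ-≤ _
    }

  -- The quotient keeps the carrier of G and replaces equality by congruence
  -- modulo H.  The induced order is x + H ≤ y + H iff x ≤ y′ for some y′ ∈ y + H.

  infix 4 _≈/_ _≤/_

  _≈/_ : Rel Carrier h
  x ≈/ y = x + - y ∈H

  _≤/_ : Rel Carrier (c ⊔ ℓ₂ ⊔ h)
  x ≤/ y = ∃[ k ] (k ∈H × x ≤ y + k)

  private
    ≈⇒≈/ : ∀ {x y} → x ≈ y → x ≈/ y
    ≈⇒≈/ {x} {y} x≈y = resp (sym (trans (+-congʳ x≈y) (-‿inverseʳ y))) 0∈

    cancel : ∀ x y → (x + - y) + y ≈ x
    cancel x y = begin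
      (x + - y) + y  ≈⟨ +-assoc x (- y) y ⟩
      x + (- y + y)  ≈⟨ +-congˡ (-‿inverseˡ y) ⟩
      x + 0#         ≈⟨ +-identityʳ x ⟩
      x              ∎

    ≈/-sym : ∀ {x y} → x ≈/ y → y ≈/ x
    ≈/-sym {x} {y} p = resp (begin
      - (x + - y)    ≈⟨ -‿+-comm x (- y) ⟨
      - x + - - y    ≈⟨ +-congˡ (-‿involutive y) ⟩
      - x + y        ≈⟨ +-comm (- x) y ⟩
      y + - x        ∎) (-‿closed p)

    ≈/-trans : ∀ {x y z} → x ≈/ y → y ≈/ z → x ≈/ z
    ≈/-trans {x} {y} {z} p q = resp (begin
      (x + - y) + (y + - z)  ≈⟨ +-assoc (x + - y) y (- z) ⟨
      (x + - y) + y + - z    ≈⟨ +-congʳ (cancel x y) ⟩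
      x + - z                ∎) (+-closed p q)

    +-cong/ : ∀ {x y u v} → x ≈/ y → u ≈/ v → x + u ≈/ y + v
    +-cong/ {x} {y} {u} {v} p q = resp (begin
      (x + - y) + (u + - v)  ≈⟨ interchange x (- y) u (- v) ⟩
      (x + u) + (- y + - v)  ≈⟨ +-congˡ (-‿+-comm y v) ⟩
      (x + u) + - (y + v)    ∎) (+-closed p q)

    -‿cong/ : ∀ {x y} → x ≈/ y → - x ≈/ - y
    -‿cong/ {x} {y} p = resp (sym (-‿+-comm x (- y))) (-‿closed p)

    ≤⇒≤/ : ∀ {x y} → x ≤ y → x ≤/ y
    ≤⇒≤/ {x} {y} p = 0# , 0∈ , ≤-respʳ-≈ (sym (+-identityʳ y)) p

    ≤/-reflexive : ∀ {x y} → x ≈/ y → x ≤/ y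
    ≤/-reflexive {x} {y} p =
      x + - y , p , ≤-reflexive (sym (trans (+-comm y (x + - y)) (cancel x y)))

    ≤/-trans : ∀ {x y z} → x ≤/ y → y ≤/ z → x ≤/ z
    ≤/-trans {x} {y} {z} (k , k∈ , x≤y+k) (l , l∈ , y≤z+l) =
      l + k , +-closed l∈ k∈ ,
      ≤-trans x≤y+k (≤-respʳ-≈ (+-assoc z l k) (+-monoˡ-≤ k y≤z+l))

    shift : ∀ {x y k} → x ≤ y + k → x + - y ≤ k
    shift {x} {y} {k} p = ≤-respʳ-≈ (begin
      (y + k) + - y  ≈⟨ +-congʳ (+-comm y k) ⟩
      (k + y) + - y  ≈⟨ +-assoc k y (- y) ⟩
      k + (y + - y)  ≈⟨ +-congˡ (-‿inverseʳ y) ⟩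
      k + 0#         ≈⟨ +-identityʳ k ⟩
      k              ∎) (+-monoˡ-≤ (- y) p)

    shift⁻ : ∀ {x y l} → y ≤ x + l → - l ≤ x + - y
    shift⁻ {x} {y} {l} p = ≤-respˡ-≈ (begin
        y + (- y + - l)  ≈⟨ +-assoc y (- y) (- l) ⟨
        (y + - y) + - l  ≈⟨ +-congʳ (-‿inverseʳ y) ⟩
        0# + - l         ≈⟨ +-identityˡ (- l) ⟩
        - l              ∎) (≤-respʳ-≈ (begin
        (x + l) + (- y + - l)  ≈⟨ interchange x l (- y) (- l) ⟩
        (x + - y) + (l + - l)  ≈⟨ +-congˡ (-‿inverseʳ l) ⟩
        (x + - y) + 0#         ≈⟨ +-identityʳ (x + - y) ⟩
        x + - y                ∎) (+-monoˡ-≤ (- y + - l) p))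

    ≤/-antisym : ∀ {x y} → x ≤/ y → y ≤/ x → x ≈/ y
    ≤/-antisym (k , k∈ , p) (l , l∈ , q) = convex (-‿closed l∈) k∈ (shift⁻ q) (shift p)

    +-monoˡ-≤/ : ∀ {x y} z → x ≤/ y → x + z ≤/ y + z
    +-monoˡ-≤/ {x} {y} z (k , k∈ , p) = k , k∈ , ≤-respʳ-≈ (begin
      (y + k) + z  ≈⟨ +-assoc y k z ⟩
      y + (k + z)  ≈⟨ +-congˡ (+-comm k z) ⟩
      y + (z + k)  ≈⟨ +-assoc y z k ⟨
      (y + z) + k  ∎) (+-monoˡ-≤ z p)

  quotient : OrderedAbelianGroup c h (c ⊔ ℓ₂ ⊔ h)
  quotient = record
    { Carrier        = Carrier
    ; _≈_            = _≈/_
    ; _≤_            = _≤/_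
    ; _+_            = _+_
    ; 0#             = 0#
    ; -_             = -_
    ; isAbelianGroup = record
      { isGroup = record
        { isMonoid = record
          { isSemigroup = record
            { isMagma = record
              { isEquivalence = record
                { refl = ≈⇒≈/ refl ; sym = ≈/-sym ; trans = ≈/-trans }
              ; ∙-cong        = +-cong/
              }
            ; assoc = λ x y z → ≈⇒≈/ (+-assoc x y z)
            }
          ; identity = (λ x → ≈⇒≈/ (+-identityˡ x)) , (λ x → ≈⇒≈/ (+-identityʳ x))
          }
        ; inverse = (λ x → ≈⇒≈/ (-‿inverseˡ x)) , (λ x → ≈⇒≈/ (-‿inverseʳ x))
        ; ⁻¹-cong = -‿cong/
        }
      ; comm = λ x y → ≈⇒≈/ (+-comm x y)
      }
    ; isTotalOrder   = record
      { isPartialOrder = record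
        { isPreorder = record
          { isEquivalence = record
            { refl = ≈⇒≈/ refl ; sym = ≈/-sym ; trans = ≈/-trans }
          ; reflexive     = ≤/-reflexive
          ; trans         = ≤/-trans
          }
        ; antisym = ≤/-antisym
        }
      ; total = λ x y → Sum.map ≤⇒≤/ ≤⇒≤/ (total x y)
      }
    ; +-monoˡ-≤      = +-monoˡ-≤/
    }

-- The archimedean class of a is represented by a itself, with _∼_ as the
-- equality of classes; the valuation v_G is then the identity on
-- representatives.  Larger absolute value means smaller class.

module _ {c ℓ₁ ℓ₂} (G : OrderedAbelianGroup c ℓ₁ ℓ₂) where
  open OrderedAbelianGroup G

  Class : Set c
  Class = Carrier

  v : Carrier → Class
  v a = a

  infix 4 _∼_ _<ᵥ_ _≤ᵥ_

  _∼_ : Rel Class ℓ₂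
  a ∼ b = ∃[ n ] (1 ℕ.≤ n × ∣ a ∣ ≤ n · ∣ b ∣ × ∣ b ∣ ≤ n · ∣ a ∣)

  _<ᵥ_ : Rel Class (ℓ₁ ⊔ ℓ₂)
  a <ᵥ b = ∣ b ∣ < ∣ a ∣ × ¬ (a ∼ b)

  _≤ᵥ_ : Rel Class (ℓ₁ ⊔ ℓ₂)
  γ ≤ᵥ δ = γ <ᵥ δ ⊎ γ ∼ δ

  -- v_G (S ∖ {0}), as a set of classes
  v[_∖0] : ∀ {s} → Pred Carrier s → Pred Class (c ⊔ ℓ₁ ⊔ ℓ₂ ⊔ s)
  v[ S ∖0] γ = ∃[ a ] (S a × a ≉ 0# × γ ∼ v a)

  HasMinimum : ∀ {s} → Pred Class s → Set (c ⊔ ℓ₁ ⊔ ℓ₂ ⊔ s)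
  HasMinimum Γ = ∃[ γ ] (Γ γ × (∀ δ → Γ δ → γ ≤ᵥ δ))

-- The language {+, -, 0, <} of ordered groups, with - as unary negation.
data Term (n : ℕ) : Set where
  var  : Fin n → Term n
  _⊕_  : Term n → Term n → Term n
  ⊖_   : Term n → Term n
  𝟎    : Term n

-- Formulas with free variables among n de Bruijn indices; a quantifier binds
-- index zero of its body.
data Formula (n : ℕ) : Set where
  _≐_ _≺_         : Term n → Term n → Formula n
  ¬′_             : Formula n → Formula n
  _∧′_ _∨′_ _⇒′_  : Formula n → Formula n → Formula n
  ∃′_ ∀′_         : Formula (ℕ.suc n) → Formula n

module _ {c ℓ₁ ℓ₂} (G : OrderedAbelianGroup c ℓ₁ ℓ₂) where
  open OrderedAbelianGroup G

  ⟦_⟧ : ∀ {n} → Term n → Vec Carrier n → Carrier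
  ⟦ var i ⟧ ρ = lookup ρ i
  ⟦ s ⊕ t ⟧ ρ = ⟦ s ⟧ ρ + ⟦ t ⟧ ρ
  ⟦ ⊖ t   ⟧ ρ = - ⟦ t ⟧ ρ
  ⟦ 𝟎     ⟧ ρ = 0#

  infix 3 _⊨_
  -- _⊨_ is Tarski's satisfaction relation; Level.Lift only brings the two
  -- kinds of atoms to a common universe.
  _⊨_ : ∀ {n} → Vec Carrier n → Formula n → Set (c ⊔ ℓ₁ ⊔ ℓ₂)
  ρ ⊨ s ≐ t    = Level.Lift (c ⊔ ℓ₂) (⟦ s ⟧ ρ ≈ ⟦ t ⟧ ρ)
  ρ ⊨ s ≺ t    = Level.Lift c (⟦ s ⟧ ρ < ⟦ t ⟧ ρ)
  ρ ⊨ ¬′ φ     = ¬ (ρ ⊨ φ)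
  ρ ⊨ φ ∧′ ψ   = (ρ ⊨ φ) × (ρ ⊨ ψ)
  ρ ⊨ φ ∨′ ψ   = (ρ ⊨ φ) ⊎ (ρ ⊨ ψ)
  ρ ⊨ φ ⇒′ ψ   = (ρ ⊨ φ) → (ρ ⊨ ψ)
  ρ ⊨ ∃′ φ     = ∃[ x ] (x ∷ ρ ⊨ φ)
  ρ ⊨ ∀′ φ     = ∀ x → (x ∷ ρ ⊨ φ)

  Definable : ∀ {s} → Pred Carrier s → Set (c ⊔ ℓ₁ ⊔ ℓ₂ ⊔ s)
  Definable S =
    ∃[ n ] Σ[ φ ∈ Formula (ℕ.suc n) ] Σ[ params ∈ Vec Carrier n ]
      (∀ x → S x ⇔ (x ∷ params ⊨ φ))

{-# OPTIONS --safe #-}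
module Submission where

-- An Ehrenfeucht–Fraïssé argument.  Both hypotheses on H reduce to one property
-- of the preimage K of the n-divisible subgroup: there is 0 < q ∈ H such that
-- every interval [ x , x + q ] with x ∈ K contains an element of n K.  Call two
-- tuples close when they are entrywise congruent modulo M K and every small
-- integer combination either agrees on the two tuples or is at least B q on
-- both or at most - B q on both.  Closeness with large constants allows any x to
-- be answered by some y with smaller constants, so close tuples satisfy the same
-- formulas of bounded complexity.  But for parameters ρ, the tuples x ∷ ρ and
-- y ∷ ρ are close as soon as x ∈ H is large, y ∈ K ∖ H is small and x ≡ y modulo
-- M K; such x and y exist, so no formula separates H from its complement.

open import Defs
open import Axiom.ExcludedMiddle using (ExcludedMiddle)
open import Data.Nat.Base using (ℕ; _≤_)
open import Data.Product using (Σ-syntax; _×_)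
open import Data.Sum.Base using (_⊎_)
open import Relation.Nullary.Negation.Core using (¬_)

open import Algebra.Bundles using (module AbelianGroup)
import Algebra.Properties.CommutativeMonoid.Mult as Mult
import Algebra.Construct.NaturalChoice.Max as Max
import Algebra.Properties.Group as GroupProperties
open import Level using (lift) renaming (_⊔_ to _⊔ℓ_)
open import Data.Empty using (⊥; ⊥-elim)
open import Data.Fin.Base using (Fin; zero; suc)
open import Data.Integer.Base as ℤ using (ℤ; +_; -[1+_]; 0ℤ; 1ℤ)
import Data.Integer.Properties as ℤ
open import Data.List.Base using (List; []; _∷_; _++_; filter; map; upTo; cartesianProductWith)
import Data.List.Extrema as Extrema
open import Data.List.Membership.Propositional using (_∈_)
open import Data.List.Membership.Propositional.Properties
  using (∈-++⁺ˡ; ∈-++⁺ʳ; ∈-map⁺; ∈-upTo⁺; ∈-filter⁺; ∈-cartesianProductWith⁺)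
open import Data.List.Relation.Unary.All as All using (All; []; _∷_)
open import Data.List.Relation.Unary.All.Properties using (all-filter)
open import Data.List.Relation.Unary.Any using (here)
open import Data.Nat.Base as ℕ using (zero; suc; NonZero; _!)
open import Data.Nat.Divisibility using (_∣_; divides; ∣-trans; m∣m*n; n∣m*n; m≤n⇒m!∣n!)
import Data.Nat.Properties as ℕ
open import Data.Product using (∃-syntax; _,_; proj₁; proj₂)
open import Data.Sum.Base using (inj₁; inj₂; [_,_]′)
open import Data.Vec.Base using (Vec; []; _∷_; lookup; zipWith; replicate) renaming (map to mapᵥ)
open import Function.Bundles using (_⇔_; module Equivalence)
open import Relation.Binary.PropositionalEquality.Core as ≡ using (_≡_)
open import Relation.Nullary.Decidable.Core using (yes; no)
import Relation.Binary.Reasoning.Setoid as SetoidReasoning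
import Relation.Binary.Reflection as Reflection

-- Integer coefficient vectors and their norm

zeroᶜ : ∀ {m} → Vec ℤ m
zeroᶜ = replicate _ 0ℤ

_+ᶜ_ : ∀ {m} → Vec ℤ m → Vec ℤ m → Vec ℤ m
_+ᶜ_ = zipWith ℤ._+_

-ᶜ_ : ∀ {m} → Vec ℤ m → Vec ℤ m
-ᶜ_ = mapᵥ (λ w → ℤ.- w)

_·ᶜ_ : ∀ {m} → ℕ → Vec ℤ m → Vec ℤ m
zero  ·ᶜ z = zeroᶜ
suc n ·ᶜ z = z +ᶜ (n ·ᶜ z)

unitᶜ : ∀ {m} → Fin m → Vec ℤ m
unitᶜ zero    = 1ℤ ∷ zeroᶜ
unitᶜ (suc i) = 0ℤ ∷ unitᶜ i

‖_‖ : ∀ {m} → Vec ℤ m → ℕ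
‖ [] ‖    = 0
‖ w ∷ z ‖ = ℤ.∣ w ∣ ℕ.+ ‖ z ‖

‖+ᶜ‖ : ∀ {m} (y z : Vec ℤ m) → ‖ y +ᶜ z ‖ ≤ ‖ y ‖ ℕ.+ ‖ z ‖
‖+ᶜ‖ []      []      = ℕ.z≤n
‖+ᶜ‖ (v ∷ y) (w ∷ z) = begin
  ℤ.∣ v ℤ.+ w ∣ ℕ.+ ‖ y +ᶜ z ‖                       ≤⟨ ℕ.+-mono-≤ (ℤ.∣i+j∣≤∣i∣+∣j∣ v w) (‖+ᶜ‖ y z) ⟩
  ℤ.∣ v ∣ ℕ.+ ℤ.∣ w ∣ ℕ.+ (‖ y ‖ ℕ.+ ‖ z ‖)          ≡⟨ interchange (ℤ.∣ v ∣) (ℤ.∣ w ∣) (‖ y ‖) (‖ z ‖) ⟩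
  ℤ.∣ v ∣ ℕ.+ ‖ y ‖ ℕ.+ (ℤ.∣ w ∣ ℕ.+ ‖ z ‖)          ∎
  where
  open ℕ.≤-Reasoning
  open import Algebra.Properties.CommutativeSemigroup ℕ.+-commutativeSemigroup using (interchange)

‖-ᶜ‖ : ∀ {m} (z : Vec ℤ m) → ‖ -ᶜ z ‖ ≡ ‖ z ‖
‖-ᶜ‖ []      = ≡.refl
‖-ᶜ‖ (w ∷ z) = ≡.cong₂ ℕ._+_ (ℤ.∣-i∣≡∣i∣ w) (‖-ᶜ‖ z)

‖zeroᶜ‖ : ∀ m → ‖ zeroᶜ {m} ‖ ≡ 0
‖zeroᶜ‖ zero    = ≡.refl
‖zeroᶜ‖ (suc m) = ‖zeroᶜ‖ m

‖·ᶜ‖ : ∀ {m} n (z : Vec ℤ m) → ‖ n ·ᶜ z ‖ ≤ n ℕ.* ‖ z ‖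
‖·ᶜ‖ {m} zero z = ℕ.≤-reflexive (‖zeroᶜ‖ m)
‖·ᶜ‖ (suc n) z = ℕ.≤-trans (‖+ᶜ‖ z (n ·ᶜ z)) (ℕ.+-monoʳ-≤ ‖ z ‖ (‖·ᶜ‖ n z))

interval : ℕ → List ℤ
interval N = map +_ (upTo (suc N)) ++ map -[1+_] (upTo N)

∈-interval : ∀ {N} w → ℤ.∣ w ∣ ≤ N → w ∈ interval N
∈-interval (+ i)    i≤N = ∈-++⁺ˡ (∈-map⁺ +_ (∈-upTo⁺ (ℕ.s≤s i≤N)))
∈-interval -[1+ i ] i<N = ∈-++⁺ʳ (map +_ (upTo _)) (∈-map⁺ -[1+_] (∈-upTo⁺ i<N))

box : ℕ → ∀ m → List (Vec ℤ m)
box N zero    = [] ∷ []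
box N (suc m) = cartesianProductWith _∷_ (interval N) (box N m)

∈-box : ∀ {N m} (z : Vec ℤ m) → ‖ z ‖ ≤ N → z ∈ box N m
∈-box []      _ = here ≡.refl
∈-box (w ∷ z) p = ∈-cartesianProductWith⁺ _∷_
  (∈-interval w (ℕ.≤-trans (ℕ.m≤m+n _ _) p))
  (∈-box z (ℕ.≤-trans (ℕ.m≤n+m _ _) p))

-- The box also contains vectors of norm above `N`. They are filtered out because a minimiser picked
-- from this list has to obey the norm bound itself.
ball : ℕ → ∀ m → List (Vec ℤ m)
ball N m = filter (λ z → ‖ z ‖ ℕ.≤? N) (box N m)

∈-ball : ∀ {N m} (z : Vec ℤ m) → ‖ z ‖ ≤ N → z ∈ ball N m
∈-ball z p = ∈-filter⁺ (λ z → ‖ z ‖ ℕ.≤? _) (∈-box z p) p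

coeffs : ∀ {m} → Term m → Vec ℤ m
coeffs (var i) = unitᶜ i
coeffs (s ⊕ t) = coeffs s +ᶜ coeffs t
coeffs (⊖ t)   = -ᶜ coeffs t
coeffs 𝟎       = zeroᶜ

-- Linear arithmetic in an ordered abelian group

module Linear {c ℓ₁ ℓ₂} (G : OrderedAbelianGroup c ℓ₁ ℓ₂) where
  open OrderedAbelianGroup G renaming (_≤_ to infix 4 _≼_)
  open GroupProperties group using () renaming (ε⁻¹≈ε to -0≈0; ⁻¹-involutive to -‿involutive)
  open import Algebra.Properties.AbelianGroup abelianGroup using ()
    renaming (⁻¹-∙-comm to -‿+-comm)
  open import Algebra.Properties.CommutativeSemigroup commutativeSemigroup using (interchange)
  open Mult (AbelianGroup.commutativeMonoid abelianGroup) public using ()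
    renaming (×-homo-+ to ·-homo-+; ×-assocˡ to ·-assocˡ; ×-distrib-+ to ·-distrib-+)
  open SetoidReasoning setoid

  infixr 8 _⋆_
  _⋆_ : ℤ → Carrier → Carrier
  (+ n)    ⋆ x = n · x
  -[1+ n ] ⋆ x = - (suc n · x)

  ⋆-neg : ∀ w x → (ℤ.- w) ⋆ x ≈ - (w ⋆ x)
  ⋆-neg (+ zero)  x = sym -0≈0
  ⋆-neg (+ suc n) x = refl
  ⋆-neg -[1+ n ]  x = sym (-‿involutive _)

  cancelˡ : ∀ x y z → (x + y) + - (x + z) ≈ y + - z
  cancelˡ x y z = begin
    (x + y) + - (x + z)    ≈⟨ +-congˡ (-‿+-comm x z) ⟨
    (x + y) + (- x + - z)  ≈⟨ interchange x y (- x) (- z) ⟩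
    (x + - x) + (y + - z)  ≈⟨ +-congʳ (-‿inverseʳ x) ⟩
    0# + (y + - z)         ≈⟨ +-identityˡ _ ⟩
    y + - z                ∎

  ⋆-⊖ : ∀ m n x → (m ℤ.⊖ n) ⋆ x ≈ m · x + - (n · x)
  ⋆-⊖ m       zero    x = sym (trans (+-congˡ -0≈0) (+-identityʳ _))
  ⋆-⊖ zero    (suc n) x = sym (+-identityˡ _)
  ⋆-⊖ (suc m) (suc n) x = begin
    (suc m ℤ.⊖ suc n) ⋆ x             ≡⟨ ≡.cong (_⋆ x) (ℤ.[1+m]⊖[1+n]≡m⊖n m n) ⟩
    (m ℤ.⊖ n) ⋆ x                     ≈⟨ ⋆-⊖ m n x ⟩
    m · x + - (n · x)                 ≈⟨ cancelˡ x (m · x) (n · x) ⟨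
    (x + m · x) + - (x + n · x)       ∎

  ⋆-homo-+ : ∀ v w x → (v ℤ.+ w) ⋆ x ≈ v ⋆ x + w ⋆ x
  ⋆-homo-+ (+ m)    (+ n)    x = ·-homo-+ x m n
  ⋆-homo-+ (+ m)    -[1+ n ] x = ⋆-⊖ m (suc n) x
  ⋆-homo-+ -[1+ m ] (+ n)    x = trans (⋆-⊖ n (suc m) x) (+-comm _ _)
  ⋆-homo-+ -[1+ m ] -[1+ n ] x = begin
    - (suc (suc (m ℕ.+ n)) · x)        ≡⟨ ≡.cong (λ k → - (k · x)) (ℕ.+-suc (suc m) n) ⟨
    - ((suc m ℕ.+ suc n) · x)          ≈⟨ -‿cong (·-homo-+ x (suc m) (suc n)) ⟩
    - (suc m · x + suc n · x)          ≈⟨ -‿+-comm _ _ ⟨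
    - (suc m · x) + - (suc n · x)      ∎

  comb : ∀ {m} → Vec ℤ m → Vec Carrier m → Carrier
  comb []      []      = 0#
  comb (w ∷ z) (x ∷ ρ) = w ⋆ x + comb z ρ

  comb-zero : ∀ {m} (ρ : Vec Carrier m) → comb zeroᶜ ρ ≈ 0#
  comb-zero []      = refl
  comb-zero (x ∷ ρ) = trans (+-identityˡ _) (comb-zero ρ)

  comb-+ : ∀ {m} (y z : Vec ℤ m) ρ → comb (y +ᶜ z) ρ ≈ comb y ρ + comb z ρ
  comb-+ []      []      []      = sym (+-identityˡ 0#)
  comb-+ (v ∷ y) (w ∷ z) (x ∷ ρ) =
    trans (+-cong (⋆-homo-+ v w x) (comb-+ y z ρ)) (interchange _ _ _ _)

  comb-neg : ∀ {m} (z : Vec ℤ m) ρ → comb (-ᶜ z) ρ ≈ - comb z ρ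
  comb-neg []      []      = sym -0≈0
  comb-neg (w ∷ z) (x ∷ ρ) = trans (+-cong (⋆-neg w x) (comb-neg z ρ)) (-‿+-comm _ _)

  comb-· : ∀ {m} n (z : Vec ℤ m) ρ → comb (n ·ᶜ z) ρ ≈ n · comb z ρ
  comb-· zero    z ρ = comb-zero ρ
  comb-· (suc n) z ρ = trans (comb-+ z (n ·ᶜ z) ρ) (+-congˡ (comb-· n z ρ))

  comb-unit : ∀ {m} (i : Fin m) ρ → comb (unitᶜ i) ρ ≈ lookup ρ i
  comb-unit zero    (x ∷ ρ) = trans (+-cong (+-identityʳ x) (comb-zero ρ)) (+-identityʳ x)
  comb-unit (suc i) (x ∷ ρ) = trans (+-identityˡ _) (comb-unit i ρ)

  comb-coeffs : ∀ {m} (t : Term m) ρ → comb (coeffs t) ρ ≈ ⟦_⟧ G t ρ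
  comb-coeffs (var i) ρ = comb-unit i ρ
  comb-coeffs (s ⊕ t) ρ =
    trans (comb-+ (coeffs s) (coeffs t) ρ) (+-cong (comb-coeffs s ρ) (comb-coeffs t ρ))
  comb-coeffs (⊖ t)   ρ = trans (comb-neg (coeffs t) ρ) (-‿cong (comb-coeffs t ρ))
  comb-coeffs 𝟎       ρ = comb-zero ρ

  -- Terms of the language of ordered groups double as solver expressions, with the coefficient
  -- vector as normal form.
  open Reflection setoid var (⟦_⟧ G) (λ t → comb (coeffs t)) comb-coeffs public
    using (solve; _⊜_)

  infixl 6 _:+_ _:-_
  _:+_ _:-_ : ∀ {m} → Term m → Term m → Term m
  _:+_    = _⊕_
  s :- t  = s ⊕ (⊖ t)

  -- Linear arithmetic: a ≤ b gives x ≤ y as soon as y - x ≈ b - a, which is stated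
  -- without subtraction for the solver.
  ≤-by : ∀ {x y a b} → a ≼ b → x + b ≈ y + a → x ≼ y
  ≤-by {x} {y} {a} {b} a≤b eq = ≤-respˡ-≈ (cancel x a) (≤-respʳ-≈ (cancel y a) (+-monoˡ-≤ (- a)
    (≤-respʳ-≈ eq (≤-respˡ-≈ (+-comm a x) (≤-respʳ-≈ (+-comm b x) (+-monoˡ-≤ x a≤b))))))
    where
    cancel : ∀ x a → x + a + - a ≈ x
    cancel = solve 2 (λ x a → x :+ a :- a ⊜ x) refl

  infixl 5 _⊞_
  _⊞_ : ∀ {w x y z} → w ≼ x → y ≼ z → w + y ≼ x + z
  _⊞_ {w} {x} {y} {z} w≤x y≤z = ≤-trans (+-monoˡ-≤ y w≤x)
    (≤-respˡ-≈ (+-comm y x) (≤-respʳ-≈ (+-comm z x) (+-monoˡ-≤ x y≤z)))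

  neg-mono : ∀ {x y} → x ≼ y → - y ≼ - x
  neg-mono {x} {y} p = ≤-by p (solve 2 (λ x y → (⊖ y) :+ y ⊜ (⊖ x) :+ x) refl x y)

  ·-neg : ∀ n x → n · (- x) ≈ - (n · x)
  ·-neg zero    x = sym -0≈0
  ·-neg (suc n) x = trans (+-congˡ (·-neg n x)) (-‿+-comm x (n · x))

  ·-zero : ∀ n → n · 0# ≈ 0#
  ·-zero zero    = refl
  ·-zero (suc n) = trans (+-identityˡ _) (·-zero n)

  ·-mono : ∀ n {x y} → x ≼ y → n · x ≼ n · y
  ·-mono zero    p = ≤-refl
  ·-mono (suc n) p = p ⊞ ·-mono n p

  0≤· : ∀ n {x} → 0# ≼ x → 0# ≼ n · x
  0≤· n p = ≤-respˡ-≈ (·-zero n) (·-mono n p)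

  ·-monoˡ : ∀ {m n x} → m ≤ n → 0# ≼ x → m · x ≼ n · x
  ·-monoˡ {n = n} ℕ.z≤n     p = 0≤· n p
  ·-monoˡ         (ℕ.s≤s q) p = ≤-refl ⊞ ·-monoˡ q p

  x≤n·x : ∀ n .{{_ : NonZero n}} {x} → 0# ≼ x → x ≼ n · x
  x≤n·x (suc n) {x} p = ≤-respˡ-≈ (+-identityʳ x) (≤-refl ⊞ 0≤· n p)

  -- Totality gives this: if `y ≼ x`, adding the resulting inequality between the remaining
  -- multiples to the hypothesis and cancelling leaves `x ≼ y`.
  ·-cancel-≤ : ∀ n .{{_ : NonZero n}} {x y} → n · x ≼ n · y → x ≼ y
  ·-cancel-≤ (suc n) {x} {y} p with total x y
  ... | inj₁ x≤y = x≤y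
  ... | inj₂ y≤x = ≤-by (p ⊞ ·-mono n y≤x)
    (solve 4 (λ x y u v → x :+ ((y :+ v) :+ u) ⊜ y :+ ((x :+ u) :+ v)) refl x y (n · x) (n · y))

  ·-cancel-≈ : ∀ n .{{_ : NonZero n}} {x y} → n · x ≈ n · y → x ≈ y
  ·-cancel-≈ n p = antisym (·-cancel-≤ n (≤-reflexive p)) (·-cancel-≤ n (≤-reflexive (sym p)))

  0≤⇒∣∣≈ : ∀ {x} → 0# ≼ x → ∣ x ∣ ≈ x
  0≤⇒∣∣≈ {x} p = Max.x≤y⇒y⊔x≈y totalOrder
    (≤-by (p ⊞ p) (solve 1 (λ x → (⊖ x) :+ (x :+ x) ⊜ x :+ (𝟎 :+ 𝟎)) refl x))

  ≤0⇒∣∣≈- : ∀ {x} → x ≼ 0# → ∣ x ∣ ≈ - x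
  ≤0⇒∣∣≈- {x} p = Max.x≤y⇒x⊔y≈y totalOrder
    (≤-by (p ⊞ p) (solve 1 (λ x → x :+ (𝟎 :+ 𝟎) ⊜ (⊖ x) :+ (x :+ x)) refl x))

  x≤∣x∣ : ∀ x → x ≼ ∣ x ∣
  x≤∣x∣ x with total 0# x
  ... | inj₁ 0≤x = ≤-reflexive (sym (0≤⇒∣∣≈ 0≤x))
  ... | inj₂ x≤0 = ≤-respʳ-≈ (sym (≤0⇒∣∣≈- x≤0))
    (≤-by (x≤0 ⊞ x≤0) (solve 1 (λ x → x :+ (𝟎 :+ 𝟎) ⊜ (⊖ x) :+ (x :+ x)) refl x))

  -x≤∣x∣ : ∀ x → - x ≼ ∣ x ∣
  -x≤∣x∣ x with total 0# x
  ... | inj₁ 0≤x = ≤-respʳ-≈ (sym (0≤⇒∣∣≈ 0≤x))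
    (≤-by (0≤x ⊞ 0≤x) (solve 1 (λ x → (⊖ x) :+ (x :+ x) ⊜ x :+ (𝟎 :+ 𝟎)) refl x))
  ... | inj₂ x≤0 = ≤-reflexive (sym (≤0⇒∣∣≈- x≤0))

  0≤∣x∣ : ∀ x → 0# ≼ ∣ x ∣
  0≤∣x∣ x with total 0# x
  ... | inj₁ 0≤x = ≤-trans 0≤x (x≤∣x∣ x)
  ... | inj₂ x≤0 = ≤-trans (≤-respˡ-≈ -0≈0 (neg-mono x≤0)) (-x≤∣x∣ x)

  ∣∣-cong : ∀ {x y} → x ≈ y → ∣ x ∣ ≈ ∣ y ∣
  ∣∣-cong {x} {y} x≈y with total 0# x
  ... | inj₁ p = trans (0≤⇒∣∣≈ p) (trans x≈y (sym (0≤⇒∣∣≈ (≤-respʳ-≈ x≈y p))))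
  ... | inj₂ p = trans (≤0⇒∣∣≈- p) (trans (-‿cong x≈y) (sym (≤0⇒∣∣≈- (≤-respˡ-≈ x≈y p))))

  ∣∣-sel : ∀ x → ∣ x ∣ ≈ x ⊎ ∣ x ∣ ≈ - x
  ∣∣-sel x with total 0# x
  ... | inj₁ 0≤x = inj₁ (0≤⇒∣∣≈ 0≤x)
  ... | inj₂ x≤0 = inj₂ (≤0⇒∣∣≈- x≤0)

-- Convex subgroups

module _ {c ℓ₁ ℓ₂ s} {G : OrderedAbelianGroup c ℓ₁ ℓ₂} (S : ConvexSubgroup G s) where
  open OrderedAbelianGroup G renaming (_≤_ to infix 4 _≼_)
  open Linear G
  open ConvexSubgroup S

  ·-closed : ∀ n {x} → x ∈H → n · x ∈H
  ·-closed zero    p = 0∈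
  ·-closed (suc n) p = +-closed p (·-closed n p)

  ∣∣-closed : ∀ {x} → x ∈H → ∣ x ∣ ∈H
  ∣∣-closed {x} p with ∣∣-sel x
  ... | inj₁ e = resp (sym e) p
  ... | inj₂ e = resp (sym e) (-‿closed p)

  ∣∣-closed⁻ : ∀ {x} → ∣ x ∣ ∈H → x ∈H
  ∣∣-closed⁻ {x} p = convex (-‿closed p) p
    (≤-by (-x≤∣x∣ x) (solve 2 (λ x a → (⊖ a) :+ a ⊜ x :- x) refl x ∣ x ∣)) (x≤∣x∣ x)

  above : ∀ {u v} → u ∈H → ¬ (v ∈H) → 0# ≼ v → u ≼ v
  above {u} {v} u∈ v∉ 0≤v with total u v
  ... | inj₁ u≤v = u≤v
  ... | inj₂ v≤u = ⊥-elim (v∉ (convex 0∈ u∈ 0≤v v≤u))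

-- Complexity of formulas

record Complexity : Set where
  constructor ⟨_,_,_⟩
  field
    -- In order: the norm up to which combinations are compared, the multiple of `q` that counts as
    -- large, and the modulus of the congruences.
    coefficients gap modulus : ℕ

open Complexity

infixl 6 _⊔_
-- Not a least upper bound: the sums dominate both bounds and the product is a multiple of both
-- moduli.
_⊔_ : Complexity → Complexity → Complexity
⟨ N , B , M ⟩ ⊔ ⟨ N′ , B′ , M′ ⟩ = ⟨ N ℕ.+ N′ , B ℕ.+ B′ , M ℕ.* M′ ⟩

-- Combinations w x + z · ρ with 0 < w ≤ N are rescaled to have the common leading
-- coefficient N !, and then differ from a nearest one by a combination of ρ; this
-- doubles the bound on the coefficients.
next : Complexity → Complexity
next ⟨ N , B , M ⟩ = ⟨ W ℕ.* N ℕ.+ W ℕ.* N , B′ ℕ.+ B′ , W ℕ.* M ⟩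
  where
  W B′ : ℕ
  W  = N !
  B′ = suc (W ℕ.* B)

level : ∀ {m} → Formula m → Complexity
-- An atom asks for the sign of `s - t`, and a value at least `q` or at most `- q` has a definite
-- one; hence gap 1.
level (s ≐ t)  = ⟨ ‖ coeffs (s ⊕ (⊖ t)) ‖ , 1 , 1 ⟩
level (s ≺ t)  = ⟨ ‖ coeffs (s ⊕ (⊖ t)) ‖ , 1 , 1 ⟩
level (¬′ φ)   = level φ
level (φ ∧′ ψ) = level φ ⊔ level ψ
level (φ ∨′ ψ) = level φ ⊔ level ψ
level (φ ⇒′ ψ) = level φ ⊔ level ψ
level (∃′ φ)   = next (level φ)
level (∀′ φ)   = next (level φ)

modulus≢0 : ∀ {m} (φ : Formula m) → NonZero (modulus (level φ))
modulus≢0 (s ≐ t)  = _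
modulus≢0 (s ≺ t)  = _
modulus≢0 (¬′ φ)   = modulus≢0 φ
modulus≢0 (φ ∧′ ψ) = ℕ.m*n≢0 _ _ {{modulus≢0 φ}} {{modulus≢0 ψ}}
modulus≢0 (φ ∨′ ψ) = ℕ.m*n≢0 _ _ {{modulus≢0 φ}} {{modulus≢0 ψ}}
modulus≢0 (φ ⇒′ ψ) = ℕ.m*n≢0 _ _ {{modulus≢0 φ}} {{modulus≢0 ψ}}
modulus≢0 (∃′ φ)   = ℕ.m*n≢0 _ _ {{coefficients (level φ) ℕ.!≢0}} {{modulus≢0 φ}}
modulus≢0 (∀′ φ)   = ℕ.m*n≢0 _ _ {{coefficients (level φ) ℕ.!≢0}} {{modulus≢0 φ}}

-- Congruence and similarity of elements

module Game {c ℓ₁ ℓ₂ k} (em : ∀ {a} → ExcludedMiddle a)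
  (G : OrderedAbelianGroup c ℓ₁ ℓ₂) (K : ConvexSubgroup G k) where
  open OrderedAbelianGroup G renaming (_≤_ to infix 4 _≼_)
  open GroupProperties group using (x∙y⁻¹≈ε⇒x≈y; x≈y⇒x∙y⁻¹≈ε)
  open Linear G
  open ConvexSubgroup K renaming
    (_∈H to infix 4 _∈K; 0∈ to 0∈K; +-closed to +-closedK; -‿closed to -‿closedK; convex to convexK; resp to respK)

  -- Asking for the quotient to lie in `K` makes congruent elements differ by an element of `K`,
  -- which anything positive outside of `K` outweighs.
  record Cong (M : ℕ) (x y : Carrier) : Set (c ⊔ℓ ℓ₁ ⊔ℓ k) where
    constructor cong
    field
      quot   : Carrier
      quot∈K : quot ∈K
      shifts : y ≈ x + M · quot

  Cong-refl : ∀ {M x} → Cong M x x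
  Cong-refl {M} {x} = cong 0# 0∈K (sym (trans (+-congˡ (·-zero M)) (+-identityʳ x)))

  Cong-sym : ∀ {M x y} → Cong M x y → Cong M y x
  Cong-sym {M} {x} {y} (cong r r∈ e) = cong (- r) (-‿closedK r∈) (
    trans (solve 2 (λ x u → x ⊜ x :+ u :- u) refl x (M · r))
      (+-cong (sym e) (sym (·-neg M r))))

  Cong-+ : ∀ {M w x y z} → Cong M w x → Cong M y z → Cong M (w + y) (x + z)
  Cong-+ {M} {w} {x} {y} {z} (cong r r∈ e) (cong r′ r′∈ e′) = cong (r + r′) (+-closedK r∈ r′∈) (
    trans (+-cong e e′) (trans
      (solve 4 (λ w y u v → (w :+ u) :+ (y :+ v) ⊜ (w :+ y) :+ (u :+ v)) refl w y (M · r) (M · r′))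
      (+-congˡ (sym (·-distrib-+ r r′ M)))))

  Cong-neg : ∀ {M x y} → Cong M x y → Cong M (- x) (- y)
  Cong-neg {M} {x} {y} (cong r r∈ e) = cong (- r) (-‿closedK r∈) (
    trans (-‿cong e) (trans (solve 2 (λ x u → ⊖ (x :+ u) ⊜ (⊖ x) :- u) refl x (M · r))
      (+-congˡ (sym (·-neg M r)))))

  Cong-· : ∀ {M x y} n → Cong M x y → Cong M (n · x) (n · y)
  Cong-· zero    p = Cong-refl
  Cong-· (suc n) p = Cong-+ p (Cong-· n p)

  Cong-⋆ : ∀ {M x y} w → Cong M x y → Cong M (w ⋆ x) (w ⋆ y)
  Cong-⋆ (+ n)    p = Cong-· n p
  Cong-⋆ -[1+ n ] p = Cong-neg (Cong-· (suc n) p)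

  Cong-comb : ∀ {M m} {ρ σ : Vec Carrier m} → (∀ i → Cong M (lookup ρ i) (lookup σ i)) →
              ∀ z → Cong M (comb z ρ) (comb z σ)
  Cong-comb {ρ = []}    {[]}    p []      = Cong-refl
  Cong-comb {ρ = x ∷ ρ} {y ∷ σ} p (w ∷ z) =
    Cong-+ (Cong-⋆ w (p zero)) (Cong-comb (λ i → p (suc i)) z)

  Cong-weaken : ∀ {M M′ x y} → M′ ∣ M → Cong M x y → Cong M′ x y
  Cong-weaken {M′ = M′} {x} (divides e ≡.refl) (cong r r∈ eq) = cong (e · r) (·-closed K e r∈) (
    trans eq (+-congˡ (sym (trans (·-assocˡ r M′ e) (reflexive (≡.cong (_· r) (ℕ.*-comm M′ e)))))))

  Similar : Carrier → Carrier → Carrier → Set _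
  Similar β x y = x ≈ y ⊎ (β ≼ x × β ≼ y) ⊎ (x ≼ - β × y ≼ - β)

  Similar-sym : ∀ {β x y} → Similar β x y → Similar β y x
  Similar-sym (inj₁ e)               = inj₁ (sym e)
  Similar-sym (inj₂ (inj₁ (p , q))) = inj₂ (inj₁ (q , p))
  Similar-sym (inj₂ (inj₂ (p , q))) = inj₂ (inj₂ (q , p))

  Similar-resp : ∀ {β w x y z} → w ≈ x → y ≈ z → Similar β w y → Similar β x z
  Similar-resp e f (inj₁ g)               = inj₁ (trans (sym e) (trans g f))
  Similar-resp e f (inj₂ (inj₁ (p , q))) = inj₂ (inj₁ (≤-respʳ-≈ e p , ≤-respʳ-≈ f q))
  Similar-resp e f (inj₂ (inj₂ (p , q))) = inj₂ (inj₂ (≤-respˡ-≈ e p , ≤-respˡ-≈ f q))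

  Similar-neg : ∀ {β x y} → Similar β x y → Similar β (- x) (- y)
  Similar-neg (inj₁ e)               = inj₁ (-‿cong e)
  Similar-neg (inj₂ (inj₁ (p , q))) = inj₂ (inj₂ (neg-mono p , neg-mono q))
  Similar-neg {β} (inj₂ (inj₂ (p , q))) = inj₂ (inj₁ (flip p , flip q))
    where
    flip : ∀ {x} → x ≼ - β → β ≼ - x
    flip {x} p = ≤-by p (solve 2 (λ x b → b :- b ⊜ (⊖ x) :+ x) refl x β)

  Similar-weaken : ∀ {β β′ x y} → β′ ≼ β → Similar β x y → Similar β′ x y
  Similar-weaken r (inj₁ e)               = inj₁ e
  Similar-weaken r (inj₂ (inj₁ (p , q))) = inj₂ (inj₁ (≤-trans r p , ≤-trans r q))
  Similar-weaken r (inj₂ (inj₂ (p , q))) =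
    inj₂ (inj₂ (≤-trans p (neg-mono r) , ≤-trans q (neg-mono r)))

  Similar-cancel : ∀ n .{{_ : NonZero n}} {β x y} → Similar (n · β) (n · x) (n · y) → Similar β x y
  Similar-cancel n (inj₁ e)               = inj₁ (·-cancel-≈ n e)
  Similar-cancel n (inj₂ (inj₁ (p , q))) = inj₂ (inj₁ (·-cancel-≤ n p , ·-cancel-≤ n q))
  Similar-cancel n {β} (inj₂ (inj₂ (p , q))) = inj₂ (inj₂ (cancel p , cancel q))
    where
    cancel : ∀ {x} → n · x ≼ - (n · β) → x ≼ - β
    cancel p = ·-cancel-≤ n (≤-respʳ-≈ (sym (·-neg n β)) p)

  ≤⇒difference≤0 : ∀ {x y} → x ≼ y → x + - y ≼ 0#
  ≤⇒difference≤0 {x} {y} p = ≤-by p (solve 2 (λ x y → x :- y :+ y ⊜ 𝟎 :+ x) refl x y)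

  difference≤0⇒≤ : ∀ {x y} → x + - y ≼ 0# → x ≼ y
  difference≤0⇒≤ {x} {y} p = ≤-by p (solve 2 (λ x y → x :+ 𝟎 ⊜ y :+ (x :- y)) refl x y)

  -- Closeness of tuples

  module _ {q : Carrier} (q∈ : q ∈K) (0≤q : 0# ≼ q) (q≉0 : q ≉ 0#) where

    q≰0 : ¬ (q ≼ 0#)
    q≰0 q≤0 = q≉0 (antisym q≤0 0≤q)

    Close : Complexity → ∀ {m} → Vec Carrier m → Vec Carrier m → Set _
    Close L ρ σ = (∀ i → Cong (modulus L) (lookup ρ i) (lookup σ i)) ×
      (∀ z → ‖ z ‖ ≤ coefficients L → Similar (gap L · q) (comb z ρ) (comb z σ))

    Close-sym : ∀ L {m} {ρ σ : Vec Carrier m} → Close L ρ σ → Close L σ ρ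
    Close-sym L (p , s) = (λ i → Cong-sym (p i)) , λ z z≤ → Similar-sym (s z z≤)

    Close-⊔ˡ : ∀ L L′ {m} {ρ σ : Vec Carrier m} → Close (L ⊔ L′) ρ σ → Close L ρ σ
    Close-⊔ˡ L L′ (p , s) = (λ i → Cong-weaken (m∣m*n _) (p i)) , λ z z≤ →
      Similar-weaken (·-monoˡ (ℕ.m≤m+n (gap L) (gap L′)) 0≤q) (s z (ℕ.≤-trans z≤ (ℕ.m≤m+n _ _)))

    Close-⊔ʳ : ∀ L L′ {m} {ρ σ : Vec Carrier m} → Close (L ⊔ L′) ρ σ → Close L′ ρ σ
    Close-⊔ʳ L L′ (p , s) = (λ i → Cong-weaken (n∣m*n (modulus L)) (p i)) , λ z z≤ →
      Similar-weaken (·-monoˡ (ℕ.m≤n+m (gap L′) (gap L)) 0≤q) (s z (ℕ.≤-trans z≤ (ℕ.m≤n+m _ _)))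

    -- Divisibility of `K` by `n` up to an error of `q`. In the application `K` is known to be
    -- divisible only modulo `H`.
    Approximable : ℕ → Set _
    Approximable n = ∀ {x} → x ∈K → ∃[ y ] (y ∈K × x ≼ n · y × n · y ≼ x + q)

    -- Passing to divisors lets one `n` serve all quantifiers of a formula, as the moduli of
    -- subformulas divide that of the formula.
    approximable-∣ : ∀ {M n} → M ∣ n → Approximable n → Approximable M
    approximable-∣ {M} (divides e ≡.refl) approx x∈ with approx x∈
    ... | y , y∈ , p , r = e · y , ·-closed K e y∈ , ≤-respʳ-≈ eq p , ≤-respˡ-≈ eq r
      where
      eq : (e ℕ.* M) · y ≈ M · (e · y)
      eq = sym (trans (·-assocˡ y M e) (reflexive (≡.cong (_· y) (ℕ.*-comm M e))))

    -- The answer to a single combination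

    module _ {M : ℕ} (approx : Approximable M) {β : Carrier} (0≤β : 0# ≼ β) (β∈ : β ∈K) where

      -- Twice `q + β`: adding some `v` between 0 and `q + β` to an element beyond this bound still
      -- leaves an absolute value of at least `β`.
      threshold : Carrier
      threshold = (q + β) + (q + β)

      -- v is the combination N ! x + z · ρ of least absolute value and v′ its answer;
      -- every other combination is v + t, to be matched with v′ + t′.
      Shift : Carrier → Carrier → Set _
      Shift v v′ = ∀ {t t′} → ∣ v ∣ ≼ ∣ v + t ∣ → Cong M t t′ → Similar threshold t t′ →
                   Similar β (v + t) (v′ + t′)

      -- Minimality of `∣ v ∣` keeps `v + t` from lying strictly between `- v` and `v`. For
      -- nonnegative `v` the two outcomes are the two sides of that interval.
      far : ∀ {v t} → ∣ v ∣ ≼ ∣ v + t ∣ → v ≼ v + t ⊎ v ≼ - (v + t)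
      far {v} {t} p with ∣∣-sel (v + t)
      ... | inj₁ e = inj₁ (≤-trans (x≤∣x∣ v) (≤-respʳ-≈ e p))
      ... | inj₂ e = inj₂ (≤-trans (x≤∣x∣ v) (≤-respʳ-≈ e p))

      -- A small `v` can answer itself: equal `t` and `t′` give equal sums, and beyond the threshold
      -- they outweigh `v`.
      shift-small : ∀ {v} → 0# ≼ v → v ≼ q + β → Shift v v
      shift-small {v} 0≤v v≤ {t} {t′} _ _ (inj₁ e) = inj₁ (+-congˡ e)
      shift-small {v} 0≤v v≤ {t} {t′} _ _ (inj₂ (inj₁ (p , p′))) = inj₂ (inj₁ (up p , up p′))
        where
        up : ∀ {t} → threshold ≼ t → β ≼ v + t
        up {t} p = ≤-by (0≤v ⊞ p ⊞ 0≤q ⊞ 0≤q ⊞ 0≤β)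
          (solve 4 (λ v t q b → b :+ (v :+ t :+ q :+ q :+ b) ⊜
            (v :+ t) :+ (𝟎 :+ ((q :+ b) :+ (q :+ b)) :+ 𝟎 :+ 𝟎 :+ 𝟎)) refl v t q β)
      shift-small {v} 0≤v v≤ {t} {t′} _ _ (inj₂ (inj₂ (p , p′))) = inj₂ (inj₂ (down p , down p′))
        where
        down : ∀ {t} → t ≼ - threshold → v + t ≼ - β
        down {t} p = ≤-by (v≤ ⊞ p ⊞ 0≤q)
          (solve 4 (λ v t q b → (v :+ t) :+ ((q :+ b) :- ((q :+ b) :+ (q :+ b)) :+ q) ⊜
            (⊖ b) :+ (v :+ t :+ 𝟎)) refl v t q β)

      -- Here v exceeds the gap, but v′ is only known to lie in [ β , β + q ]: as v is
      -- nearest to 0, t is either nonnegative or at most - 2 v.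
      shift-medium : ∀ {v v′} → q + β ≼ v → β ≼ v′ → v′ ≼ β + q → Shift v v′
      shift-medium {v} {v′} v≥ β≤v′ v′≤ {t} {t′} f _ sim with far {v} {t} f
      ... | inj₁ near = right sim
        where
        β≤v+t : β ≼ v + t
        β≤v+t = ≤-by (v≥ ⊞ near ⊞ 0≤q) (solve 4 (λ v t q b → b :+ (v :+ (v :+ t) :+ q) ⊜
          (v :+ t) :+ ((q :+ b) :+ v :+ 𝟎)) refl v t q β)
        right : Similar threshold t t′ → Similar β (v + t) (v′ + t′)
        right (inj₁ e) = inj₂ (inj₁ (β≤v+t , ≤-respʳ-≈ (+-congˡ e)
          (≤-by (β≤v′ ⊞ near) (solve 4 (λ v v′ t b → b :+ (v′ :+ (v :+ t)) ⊜
            (v′ :+ t) :+ (b :+ v)) refl v v′ t β))))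
        right (inj₂ (inj₁ (_ , p))) = inj₂ (inj₁ (β≤v+t ,
          ≤-by (β≤v′ ⊞ p ⊞ 0≤q ⊞ 0≤q ⊞ 0≤β ⊞ 0≤β) (solve 4 (λ v′ t q b →
            b :+ (v′ :+ t :+ q :+ q :+ b :+ b) ⊜
            (v′ :+ t) :+ (b :+ ((q :+ b) :+ (q :+ b)) :+ 𝟎 :+ 𝟎 :+ 𝟎 :+ 𝟎)) refl v′ t′ q β)))
        -- Here `t` is nonnegative and cannot lie below `- threshold`.
        right (inj₂ (inj₂ (p , _))) = ⊥-elim (q≰0
          (≤-by (p ⊞ near ⊞ 0≤q ⊞ 0≤β ⊞ 0≤β) (solve 4 (λ v t q b →
            q :+ ((⊖ ((q :+ b) :+ (q :+ b))) :+ (v :+ t) :+ q :+ b :+ b) ⊜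
            𝟎 :+ (t :+ v :+ 𝟎 :+ 𝟎 :+ 𝟎)) refl v t q β)))
      ... | inj₂ near = left sim
        where
        v+t≤-β : v + t ≼ - β
        v+t≤-β = ≤-by (v≥ ⊞ near ⊞ 0≤q) (solve 4 (λ v t q b → (v :+ t) :+ (v :- (v :+ t) :+ q) ⊜
          (⊖ b) :+ ((q :+ b) :+ v :+ 𝟎)) refl v t q β)
        left : Similar threshold t t′ → Similar β (v + t) (v′ + t′)
        -- `v′ + t` is at most `β + q` minus twice `v`, hence at most `- (q + β)`.
        left (inj₁ e) = inj₂ (inj₂ (v+t≤-β , ≤-respˡ-≈ (+-congˡ e)
          (≤-by (v′≤ ⊞ near ⊞ v≥ ⊞ v≥ ⊞ 0≤q) (solve 5 (λ v v′ t q b →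
            (v′ :+ t) :+ ((b :+ q) :- (v :+ t) :+ v :+ v :+ q) ⊜
            (⊖ b) :+ (v′ :+ v :+ (q :+ b) :+ (q :+ b) :+ 𝟎)) refl v v′ t q β))))
        -- Here `t` is at most minus twice `v`, hence negative, and cannot exceed the threshold.
        left (inj₂ (inj₁ (p , _))) = ⊥-elim (q≰0
          (≤-by (p ⊞ near ⊞ v≥ ⊞ v≥ ⊞ 0≤q ⊞ 0≤q ⊞ 0≤q ⊞ 0≤β ⊞ 0≤β ⊞ 0≤β ⊞ 0≤β) (solve 4 (λ v t q b →
            q :+ (t :- (v :+ t) :+ v :+ v :+ q :+ q :+ q :+ b :+ b :+ b :+ b) ⊜
            𝟎 :+ (((q :+ b) :+ (q :+ b)) :+ v :+ (q :+ b) :+ (q :+ b) :+ 𝟎 :+ 𝟎 :+ 𝟎 :+ 𝟎 :+ 𝟎 :+ 𝟎 :+ 𝟎)) refl v t q β)))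
        left (inj₂ (inj₂ (_ , p))) = inj₂ (inj₂ (v+t≤-β ,
          ≤-by (v′≤ ⊞ p ⊞ 0≤q) (solve 4 (λ v′ t q b →
            (v′ :+ t) :+ ((b :+ q) :- ((q :+ b) :+ (q :+ b)) :+ q) ⊜
            (⊖ b) :+ (v′ :+ t :+ 𝟎)) refl v′ t′ q β)))

      -- v ∉ K dominates β as well as the difference of t and t′.
      shift-large : ∀ {v} → 0# ≼ v → ¬ (v ∈K) → Shift v v
      shift-large {v} 0≤v v∉ {t} {t′} f (cong r r∈ e) _ with far {v} {t} f
      ... | inj₁ near = inj₂ (inj₁ (≤-trans (above K β∈ v∉ 0≤v) near , ≤-respʳ-≈ (sym (+-congˡ e))
        (≤-by (above K (+-closedK β∈ (-‿closedK (·-closed K M r∈))) v∉ 0≤v ⊞ near)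
          (solve 4 (λ v t b u → b :+ (v :+ (v :+ t)) ⊜ (v :+ (t :+ u)) :+ ((b :- u) :+ v))
            refl v t β (M · r)))))
      ... | inj₂ near = inj₂ (inj₂ (≤-trans v+t≤-v (neg-mono (above K β∈ v∉ 0≤v)) ,
        ≤-respˡ-≈ (sym (+-congˡ e))
          (≤-by (above K (+-closedK β∈ (·-closed K M r∈)) v∉ 0≤v ⊞ near)
            (solve 4 (λ v t b u → (v :+ (t :+ u)) :+ (v :- (v :+ t)) ⊜ (⊖ b) :+ ((b :+ u) :+ v))
              refl v t β (M · r)))))
        where
        v+t≤-v : v + t ≼ - v
        v+t≤-v = ≤-by near (solve 2 (λ v t → (v :+ t) :- (v :+ t) ⊜ (⊖ v) :+ v) refl v t)

      shift⁺ : ∀ {v} → 0# ≼ v → ∃[ v′ ] (Cong M v v′ × Shift v v′)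
      shift⁺ {v} 0≤v with em {P = v ∈K} | total v (q + β)
      ... | no v∉  | _       = v , Cong-refl , shift-large 0≤v v∉
      ... | yes v∈ | inj₁ v≤ = v , Cong-refl , shift-small 0≤v v≤
      -- Approximating `β - v` by a multiple `M · y` moves `v` into the interval from `β` to `β + q`
      -- without leaving its congruence class.
      ... | yes v∈ | inj₂ v≥ with approx (+-closedK β∈ (-‿closedK v∈))
      ...   | y , y∈ , p , p′ = v + M · y , cong y y∈ refl , shift-medium v≥
        (≤-by p (solve 3 (λ v b u → b :+ u ⊜ (v :+ u) :+ (b :- v)) refl v β (M · y)))
        (≤-by p′ (solve 4 (λ v b u q → (v :+ u) :+ (b :- v :+ q) ⊜ (b :+ q) :+ u) refl v β (M · y) q))

      ∣∣-cong-neg : ∀ {x y} → y ≈ - x → ∣ x ∣ ≼ ∣ y ∣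
      ∣∣-cong-neg {x} {y} e with ∣∣-sel x
      ... | inj₁ f = ≤-respˡ-≈ (sym f) (≤-trans (≤-reflexive
        (trans (solve 1 (λ x → x ⊜ ⊖ (⊖ x)) refl x) (-‿cong (sym e)))) (-x≤∣x∣ y))
      ... | inj₂ f = ≤-respˡ-≈ (sym f) (≤-trans (≤-reflexive (sym e)) (x≤∣x∣ y))

      -- A negative `v` is reduced to the nonnegative case by negating `v`, `t` and `t′`; all the
      -- relations involved are invariant under this.
      shift : ∀ v → ∃[ v′ ] (Cong M v v′ × Shift v v′)
      shift v with total 0# v
      ... | inj₁ 0≤v = shift⁺ 0≤v
      ... | inj₂ v≤0 with shift⁺ (≤-by v≤0 (solve 1 (λ v → 𝟎 :+ 𝟎 ⊜ (⊖ v) :+ v) refl v))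
      ...   | v′ , cg , sh = - v′ , Cong-neg′ cg , λ {t} {t′} f ct sim →
        Similar-resp
          (solve 2 (λ v t → ⊖ ((⊖ v) :- t) ⊜ v :+ t) refl v t)
          (solve 2 (λ v t → ⊖ (v :- t) ⊜ (⊖ v) :+ t) refl v′ t′)
          (Similar-neg (sh {t = - t} {t′ = - t′}
            (≤-trans (∣∣-cong-neg (solve 1 (λ v → v ⊜ ⊖ (⊖ v)) refl v)) (≤-trans f
              (∣∣-cong-neg (solve 2 (λ v t → (⊖ v) :- t ⊜ ⊖ (v :+ t)) refl v t))))
            (Cong-neg ct) (Similar-neg sim)))
        where
        Cong-neg′ : Cong M (- v) v′ → Cong M v (- v′)
        Cong-neg′ p with Cong-neg p
        ... | cong r r∈ e = cong r r∈ (trans e (+-congʳ (solve 1 (λ v → ⊖ (⊖ v) ⊜ v) refl v)))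

    -- One move of the game

    module Step (L : Complexity) {m} {ρ σ : Vec Carrier m}
      (approx : Approximable (modulus (next L))) (close : Close (next L) ρ σ) (x : Carrier) where
      open Complexity L renaming (coefficients to N; gap to B; modulus to M)

      W : ℕ
      W = N !

      -- `W` times the gap of `L`, so that cancelling any factor `e ≤ W` still leaves `B · q`.
      β : Carrier
      β = (W ℕ.* B) · q

      near : Vec ℤ m
      -- The default `zeroᶜ` has norm 0, so it respects the bound too.
      near = Extrema.argmin totalOrder (λ z → ∣ W · x + comb z ρ ∣) zeroᶜ (ball (W ℕ.* N) m)

      ‖near‖ : ‖ near ‖ ≤ W ℕ.* N
      ‖near‖ = Extrema.argmin-all totalOrder (λ z → ∣ W · x + comb z ρ ∣) {P = λ z → ‖ z ‖ ≤ W ℕ.* N}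
        (ℕ.≤-trans (ℕ.≤-reflexive (‖zeroᶜ‖ m)) ℕ.z≤n)
        (all-filter (λ z → ‖ z ‖ ℕ.≤? W ℕ.* N) (box (W ℕ.* N) m))

      near-least : ∀ z → ‖ z ‖ ≤ W ℕ.* N → ∣ W · x + comb near ρ ∣ ≼ ∣ W · x + comb z ρ ∣
      near-least z p = All.lookup (Extrema.f[argmin]≤f[xs] totalOrder zeroᶜ (ball (W ℕ.* N) m)) (∈-ball z p)

      u : Carrier
      u = W · x + comb near ρ

      shifted : ∃[ u′ ] (Cong (W ℕ.* M) u u′ × Shift approx (0≤· (W ℕ.* B) 0≤q) (·-closed K (W ℕ.* B) q∈) u u′)
      shifted = shift approx (0≤· (W ℕ.* B) 0≤q) (·-closed K (W ℕ.* B) q∈) u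

      u′ : Carrier
      u′ = proj₁ shifted

      open Cong (proj₁ (proj₂ shifted)) renaming (quot to a; quot∈K to a∈; shifts to u′≈)
      open Cong (Cong-comb {ρ = ρ} {σ} (proj₁ close) near) renaming (quot to b; quot∈K to b∈; shifts to near≈)

      -- Solved from `W · y + comb near σ ≈ u′`: passing from `u` to `u′` adds `(W ℕ.* M) · a`, and
      -- passing from `ρ` to `σ` adds `(W ℕ.* M) · b` to the nearest combination. The factor `W` in
      -- the modulus is what permits division by `W`.
      y : Carrier
      y = x + M · (a + - b)

      Wy≈ : W · y + comb near σ ≈ u′
      Wy≈ = begin
        W · y + comb near σ
          ≈⟨ +-cong (trans (·-distrib-+ x (M · (a + - b)) W) (+-congˡ (·-assocˡ (a + - b) W M))) near≈ ⟩
        W · x + (W ℕ.* M) · (a + - b) + (comb near ρ + (W ℕ.* M) · b)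
          ≈⟨ +-congʳ (+-congˡ (trans (·-distrib-+ a (- b) (W ℕ.* M)) (+-congˡ (·-neg (W ℕ.* M) b)))) ⟩
        W · x + ((W ℕ.* M) · a + - ((W ℕ.* M) · b)) + (comb near ρ + (W ℕ.* M) · b)
          ≈⟨ solve 4 (λ x a b r → x :+ (a :- b) :+ (r :+ b) ⊜ x :+ r :+ a) refl _ _ _ _ ⟩
        u + (W ℕ.* M) · a
          ≈⟨ u′≈ ⟨
        u′ ∎
        where open SetoidReasoning setoid

      -- The combination of `z` is `u` plus that of `z - near`, whose norm is at most
      -- `W ℕ.* N + W ℕ.* N`. This is the coefficient bound of `next L`.
      similar-W : ∀ z → ‖ z ‖ ≤ W ℕ.* N → Similar β (W · x + comb z ρ) (W · y + comb z σ)
      similar-W z p = Similar-resp u+t≈ u′+t′≈ (proj₂ (proj₂ shifted) {comb (z +ᶜ (-ᶜ near)) ρ} {comb (z +ᶜ (-ᶜ near)) σ}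
        (≤-trans (near-least z p) (≤-reflexive (∣∣-cong (sym u+t≈))))
        (Cong-comb (proj₁ close) (z +ᶜ (-ᶜ near)))
        -- The gap of `next L` times `q` is exactly `threshold`.
        (Similar-weaken (≤-reflexive (sym (·-homo-+ q (suc (W ℕ.* B)) (suc (W ℕ.* B)))))
          (proj₂ close (z +ᶜ (-ᶜ near))
            (ℕ.≤-trans (‖+ᶜ‖ z (-ᶜ near))
              (ℕ.+-mono-≤ p (ℕ.≤-trans (ℕ.≤-reflexive (‖-ᶜ‖ near)) ‖near‖))))))
        where
        diff : ∀ τ → comb (z +ᶜ (-ᶜ near)) τ ≈ comb z τ + - comb near τ
        diff τ = trans (comb-+ z (-ᶜ near) τ) (+-congˡ (comb-neg near τ))
        u+t≈ : u + comb (z +ᶜ (-ᶜ near)) ρ ≈ W · x + comb z ρ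
        u+t≈ = trans (+-congˡ (diff ρ))
          (solve 3 (λ x n z → (x :+ n) :+ (z :- n) ⊜ x :+ z) refl (W · x) (comb near ρ) (comb z ρ))
        u′+t′≈ : u′ + comb (z +ᶜ (-ᶜ near)) σ ≈ W · y + comb z σ
        u′+t′≈ = trans (+-cong (sym Wy≈) (diff σ))
          (solve 3 (λ x n z → (x :+ n) :+ (z :- n) ⊜ x :+ z) refl (W · y) (comb near σ) (comb z σ))

      instance
        W≢0 : NonZero W
        W≢0 = N ℕ.!≢0

      -- As `suc w ≤ N`, it divides `W` with some cofactor `e`. Multiplying by `e` makes the leading
      -- coefficient `W` and keeps the norm of the rest within `W ℕ.* N`; afterwards `e` cancels.
      similar-suc : ∀ w z → suc w ℕ.+ ‖ z ‖ ≤ N →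
                    Similar (B · q) (suc w · x + comb z ρ) (suc w · y + comb z σ)
      similar-suc w z p with ∣-trans (m∣m*n (w !)) (m≤n⇒m!∣n! {suc w} (ℕ.≤-trans (ℕ.m≤m+n _ _) p))
      ... | divides e W≡ = Similar-cancel e (Similar-resp (scale x ρ) (scale y σ)
        (Similar-weaken (≤-respˡ-≈ (sym (·-assocˡ q e B)) (·-monoˡ (ℕ.*-monoˡ-≤ B e≤W) 0≤q))
          (similar-W (e ·ᶜ z) (ℕ.≤-trans (‖·ᶜ‖ e z) (ℕ.*-mono-≤ e≤W (ℕ.≤-trans (ℕ.m≤n+m _ _) p))))))
        where
        instance
          e≢0 : NonZero e
          e≢0 = ℕ.m*n≢0⇒m≢0 e {{≡.subst NonZero W≡ W≢0}}
        e≤W : e ≤ W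
        e≤W = ℕ.≤-trans (ℕ.m≤m*n e (suc w)) (ℕ.≤-reflexive (≡.sym W≡))
        scale : ∀ r τ → W · r + comb (e ·ᶜ z) τ ≈ e · (suc w · r + comb z τ)
        scale r τ = trans
          (+-cong (trans (reflexive (≡.cong (_· r) W≡)) (sym (·-assocˡ r e (suc w)))) (comb-· e z τ))
          (sym (·-distrib-+ _ _ e))

      similar : ∀ z → ‖ z ‖ ≤ N → Similar (B · q) (comb z (x ∷ ρ)) (comb z (y ∷ σ))
      similar (+ zero ∷ z) p = Similar-resp (sym (+-identityˡ _)) (sym (+-identityˡ _))
        (Similar-weaken (·-monoˡ (ℕ.≤-trans (ℕ.m≤n*m B W) (ℕ.≤-trans (ℕ.n≤1+n _) (ℕ.m≤m+n _ _))) 0≤q)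
          (proj₂ close z (ℕ.≤-trans p (ℕ.≤-trans (ℕ.m≤n*m N W) (ℕ.m≤m+n _ _)))))
      similar (+ suc w ∷ z) p = similar-suc w z p
      similar (-[1+ w ] ∷ z) p = Similar-resp (flip x ρ) (flip y σ)
        (Similar-neg (similar-suc w (-ᶜ z) (≡.subst (λ l → suc w ℕ.+ l ≤ N) (≡.sym (‖-ᶜ‖ z)) p)))
        where
        flip : ∀ r τ → - (suc w · r + comb (-ᶜ z) τ) ≈ - (suc w · r) + comb z τ
        flip r τ = trans (-‿cong (+-congˡ (comb-neg z τ)))
          (solve 2 (λ u z → ⊖ (u :- z) ⊜ (⊖ u) :+ z) refl (suc w · r) (comb z τ))

      step : ∃[ y ] Close L (x ∷ ρ) (y ∷ σ)
      step = y , congs , similar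
        where
        congs : ∀ i → Cong M (lookup (x ∷ ρ) i) (lookup (y ∷ σ) i)
        congs zero    = cong (a + - b) (+-closedK a∈ (-‿closedK b∈)) refl
        congs (suc i) = Cong-weaken (n∣m*n W) (proj₁ close i)

    open Step using (step)

    -- Close tuples satisfy the same formulas

    module _ {n} (approx : Approximable n) where

      difference : ∀ {m} (s t : Term m) ρ → comb (coeffs (s ⊕ (⊖ t))) ρ ≈ ⟦_⟧ G s ρ + - ⟦_⟧ G t ρ
      difference s t ρ = comb-coeffs (s ⊕ (⊖ t)) ρ

      close-difference : ∀ {m} (s t : Term m) {ρ σ : Vec Carrier m} → Close (level (s ≐ t)) ρ σ →
        Similar q (⟦_⟧ G s ρ + - ⟦_⟧ G t ρ) (⟦_⟧ G s σ + - ⟦_⟧ G t σ)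
      close-difference s t {ρ} {σ} (_ , p) =
        Similar-weaken (≤-reflexive (sym (+-identityʳ q)))
          (Similar-resp (difference s t ρ) (difference s t σ) (p (coeffs (s ⊕ (⊖ t))) ℕ.≤-refl))

      -- Induction on `φ`. Negations and premises run backwards by symmetry of closeness; for a
      -- universal quantifier the challenge is played on the side of `σ` and answered on the side of
      -- `ρ`.
      transfer : ∀ {m} (φ : Formula m) → modulus (level φ) ∣ n → ∀ {ρ σ : Vec Carrier m} →
                 Close (level φ) ρ σ → _⊨_ G ρ φ → _⊨_ G σ φ
      transfer (s ≐ t) _ cl (lift e) with close-difference s t cl
      ... | inj₁ f              = lift (x∙y⁻¹≈ε⇒x≈y _ _ (trans (sym f) (x≈y⇒x∙y⁻¹≈ε e)))
      ... | inj₂ (inj₁ (p , _)) = ⊥-elim (q≰0 (≤-respʳ-≈ (x≈y⇒x∙y⁻¹≈ε e) p))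
      ... | inj₂ (inj₂ (p , _)) = ⊥-elim (q≰0 (≤-by p
        (trans (-‿inverseʳ q) (sym (trans (+-identityˡ _) (x≈y⇒x∙y⁻¹≈ε e))))))
      transfer (s ≺ t) _ cl (lift (s≤t , s≉t)) with close-difference s t cl
      ... | inj₁ f              = lift
        ( difference≤0⇒≤ (≤-respˡ-≈ f (≤⇒difference≤0 s≤t))
        , λ e → s≉t (x∙y⁻¹≈ε⇒x≈y _ _ (trans f (x≈y⇒x∙y⁻¹≈ε e))))
      ... | inj₂ (inj₁ (p , _)) = ⊥-elim (q≰0 (≤-trans p (≤⇒difference≤0 s≤t)))
      ... | inj₂ (inj₂ (_ , p)) = lift
        ( difference≤0⇒≤ (≤-trans p (≤-by 0≤q (solve 1 (λ q → (⊖ q) :+ q ⊜ 𝟎 :+ 𝟎) refl q)))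
        , λ e → q≰0 (≤-by p (trans (-‿inverseʳ q) (sym (trans (+-identityˡ _) (x≈y⇒x∙y⁻¹≈ε e))))))
      transfer (¬′ φ) d cl h g = h (transfer φ d (Close-sym (level φ) cl) g)
      transfer (φ ∧′ ψ) d cl (h , g) =
        transfer φ (∣-trans (m∣m*n _) d) (Close-⊔ˡ (level φ) (level ψ) cl) h ,
        transfer ψ (∣-trans (n∣m*n (modulus (level φ))) d) (Close-⊔ʳ (level φ) (level ψ) cl) g
      transfer (φ ∨′ ψ) d cl (inj₁ h) =
        inj₁ (transfer φ (∣-trans (m∣m*n _) d) (Close-⊔ˡ (level φ) (level ψ) cl) h)
      transfer (φ ∨′ ψ) d cl (inj₂ g) =
        inj₂ (transfer ψ (∣-trans (n∣m*n (modulus (level φ))) d) (Close-⊔ʳ (level φ) (level ψ) cl) g)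
      transfer (φ ⇒′ ψ) d cl h g =
        transfer ψ (∣-trans (n∣m*n (modulus (level φ))) d) (Close-⊔ʳ (level φ) (level ψ) cl)
          (h (transfer φ (∣-trans (m∣m*n _) d)
            (Close-sym (level φ) (Close-⊔ˡ (level φ) (level ψ) cl)) g))
      transfer (∃′ φ) d cl (x , h) with step (level φ) (approximable-∣ d approx) cl x
      ... | y , cl′ = y , transfer φ (∣-trans (n∣m*n (coefficients (level φ) !)) d) cl′ h
      transfer (∀′ φ) d cl h y with step (level φ) (approximable-∣ d approx)
        (Close-sym (next (level φ)) cl) y
      ... | x , cl′ = transfer φ (∣-trans (n∣m*n (coefficients (level φ) !)) d)
        (Close-sym (level φ) cl′) (h x)

      -- Close elements inside and outside of `H`

      module Separation {h} (H : ConvexSubgroup G h)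
        (q∈H : ConvexSubgroup._∈H H q)
        {g₀ : Carrier} (g₀∈K : g₀ ∈K) (g₀∉H : ¬ ConvexSubgroup._∈H H g₀)
        {{_ : NonZero n}} where
        open ConvexSubgroup H

        -- The witness is the sum of the absolute values of those listed elements that lie in `H`.
        upper : ∀ xs → ∃[ x ] (x ∈H × 0# ≼ x × All (λ s → s ∈H → ∣ s ∣ ≼ x) xs)
        upper []       = 0# , 0∈ , ≤-refl , []
        upper (s ∷ xs) with upper xs | em {P = s ∈H}
        ... | x , x∈ , 0≤x , p | no s∉  = x , x∈ , 0≤x , (λ s∈ → ⊥-elim (s∉ s∈)) ∷ p
        ... | x , x∈ , 0≤x , p | yes s∈ =
          ∣ s ∣ + x , +-closed (∣∣-closed H s∈) x∈ , ≤-respˡ-≈ (+-identityˡ 0#) (0≤∣x∣ s ⊞ 0≤x) ,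
          (λ _ → ≤-respˡ-≈ (+-identityʳ _) (≤-refl ⊞ 0≤x)) ∷
          All.map (λ f s∈ → ≤-respˡ-≈ (+-identityˡ _) (0≤∣x∣ s ⊞ f s∈)) p

        -- Approximating `x - q` instead of `x` puts `n · y` between `x - q` and `x`. Were `y` in
        -- `H`, so would be `n · y + q`, and with it `x`.
        divide : ∀ {x V} → V ≤ n → x ∈K → ¬ (x ∈H) → 0# ≼ x →
                 ∃[ y ] (y ∈K × ¬ (y ∈H) × 0# ≼ y × V · y ≼ x)
        divide {x} V≤n x∈ x∉ 0≤x with approx (+-closedK x∈ (-‿closedK q∈))
        ... | y , y∈ , p , r = y , y∈ , y∉ , 0≤y ,
          ≤-trans (·-monoˡ V≤n 0≤y) (≤-respʳ-≈ (solve 2 (λ x q → x :- q :+ q ⊜ x) refl x q) r)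
          where
          y∉ : ¬ (y ∈H)
          y∉ y∈H = x∉ (convex 0∈ (+-closed (·-closed H n y∈H) q∈H) 0≤x
            (≤-by p (solve 3 (λ x q u → x :+ u ⊜ (u :+ q) :+ (x :- q)) refl x q (n · y))))
          0≤y : 0# ≼ y
          0≤y = ·-cancel-≤ n (≤-respˡ-≈ (sym (·-zero n)) (≤-by (above H q∈H x∉ 0≤x ⊞ p)
            (solve 3 (λ x q u → 𝟎 :+ (x :+ u) ⊜ u :+ (q :+ (x :- q))) refl x q (n · y))))

        -- Starts from `∣ g₀ ∣`. A listed `s` outside of `H` with `∣ s ∣ ≼ V · x` belongs to `K` by
        -- convexity, so `∣ s ∣` can be divided; the smaller of `x` and the result is kept.
        lower : ∀ {V} → V ≤ n → ∀ xs →
          ∃[ x ] (x ∈K × ¬ (x ∈H) × 0# ≼ x × All (λ s → ¬ (s ∈H) → V · x ≼ ∣ s ∣) xs)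
        lower V≤n [] = ∣ g₀ ∣ , ∣∣-closed K g₀∈K , (λ p → g₀∉H (∣∣-closed⁻ H p)) , 0≤∣x∣ g₀ , []
        lower {V} V≤n (s ∷ xs) with lower V≤n xs | em {P = s ∈H}
        ... | x , x∈ , x∉ , 0≤x , p | yes s∈ = x , x∈ , x∉ , 0≤x , (λ s∉ → ⊥-elim (s∉ s∈)) ∷ p
        ... | x , x∈ , x∉ , 0≤x , p | no s∉ with total (V · x) ∣ s ∣
        ...   | inj₁ Vx≤s = x , x∈ , x∉ , 0≤x , (λ _ → Vx≤s) ∷ p
        ...   | inj₂ s≤Vx with divide V≤n (convexK 0∈K (·-closed K V x∈) (0≤∣x∣ s) s≤Vx)
                  (λ r → s∉ (∣∣-closed⁻ H r)) (0≤∣x∣ s)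
        ...     | y , y∈ , y∉ , 0≤y , Vy≤s with total x y
        ...       | inj₁ x≤y = x , x∈ , x∉ , 0≤x , (λ _ → ≤-trans (·-mono V x≤y) Vy≤s) ∷ p
        ...       | inj₂ y≤x = y , y∈ , y∉ , 0≤y , (λ _ → Vy≤s) ∷
                    All.map (λ f s∉ → ≤-trans (·-mono V y≤x) (f s∉)) p

        module _ (L : Complexity) {{_ : NonZero (modulus L)}} (M∣n : modulus L ∣ n)
          (N<n : suc (coefficients L) ≤ n) {m} (ρ : Vec Carrier m) where
          open Complexity L renaming (coefficients to N; gap to B; modulus to M)

          β : Carrier
          β = B · q

          -- First `y` is taken below all relevant values outside of `H`. As `y - M · a` lies
          -- between `- q` and 0, it is in `H` and congruent to `y`; adding `M · b` with a large `b`
          -- from `H` makes it exceed the relevant values in `H`.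
          separate : ∃[ x ] ∃[ y ] (x ∈H × ¬ (y ∈H) × Close L (x ∷ ρ) (y ∷ ρ))
          separate with upper (map (λ z → comb z ρ) (ball N m)) | lower N<n (map (λ z → comb z ρ) (ball N m))
          ... | u , u∈ , 0≤u , u≥ | y , y∈ , y∉ , 0≤y , y≤ with approximable-∣ M∣n approx y∈
          ...   | a , a∈ , y≤Ma , Ma≤ = x , y , x∈ , y∉ , congs , similar
            where
            b : Carrier
            -- The summand `q` makes up for `y - M · a` being possibly as low as `- q`.
            b = u + β + q
            β∈ : β ∈H
            β∈ = ·-closed H B q∈H
            0≤β : 0# ≼ β
            0≤β = 0≤· B 0≤q
            b∈ : b ∈H
            b∈ = +-closed (+-closed u∈ β∈) q∈H
            0≤b : 0# ≼ b
            0≤b = ≤-by (0≤u ⊞ 0≤β ⊞ 0≤q) (solve 1 (λ b → 𝟎 :+ b ⊜ b :+ (𝟎 :+ 𝟎 :+ 𝟎)) refl b)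
            x : Carrier
            x = y + - (M · a) + M · b
            x∈ : x ∈H
            x∈ = +-closed
              (convex (-‿closed q∈H) 0∈
                (≤-by Ma≤ (solve 3 (λ y u q → (⊖ q) :+ (y :+ q) ⊜ (y :- u) :+ u) refl y (M · a) q))
                (≤⇒difference≤0 y≤Ma))
              (·-closed H M b∈)
            x≥ : u + β ≼ x
            x≥ = ≤-by (x≤n·x M 0≤b ⊞ Ma≤) (solve 6 (λ u B q y a b →
              (u :+ B) :+ (b :+ (y :+ q)) ⊜ (y :- a :+ b) :+ ((u :+ B :+ q) :+ a))
              refl u β q y (M · a) (M · b))
            0≤x : 0# ≼ x
            0≤x = ≤-by (x≥ ⊞ 0≤u ⊞ 0≤β) (solve 3 (λ x u b → 𝟎 :+ (x :+ u :+ b) ⊜ x :+ ((u :+ b) :+ 𝟎 :+ 𝟎)) refl x u β)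
            congs : ∀ i → Cong M (lookup (x ∷ ρ) i) (lookup (y ∷ ρ) i)
            congs zero    = cong (a + - b) (+-closedK a∈ (-‿closedK b∈K)) (trans
              (solve 3 (λ y a b → y ⊜ (y :- a :+ b) :+ (a :- b)) refl y (M · a) (M · b))
              (+-congˡ (sym (trans (·-distrib-+ a (- b) M) (+-congˡ (·-neg M b))))))
              where
              -- As an element of `H`, `b` is below `∣ g₀ ∣`, which is in `K` but not in `H`.
              b∈K : b ∈K
              b∈K = convexK 0∈K (∣∣-closed K g₀∈K) 0≤b
                (above H b∈ (λ p → g₀∉H (∣∣-closed⁻ H p)) (0≤∣x∣ g₀))
            congs (suc i) = Cong-refl

            -- Let `s` be the value of `z` at `ρ`. If `s` is in `H`, both `x` and `y` exceed `∣ s ∣`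
            -- by at least `β`. Otherwise `s` outweighs `H` as well as `suc w` copies of `y`, so its
            -- sign decides.
            similar-suc : ∀ w z → suc w ℕ.+ ‖ z ‖ ≤ N →
                          Similar β (suc w · x + comb z ρ) (suc w · y + comb z ρ)
            similar-suc w z p = case-∈
              where
              s : Carrier
              s = comb z ρ
              s-listed : s ∈ map (λ z → comb z ρ) (ball N m)
              s-listed = ∈-map⁺ _ (∈-ball z (ℕ.≤-trans (ℕ.m≤n+m _ _) p))
              grow : ∀ {r} → 0# ≼ r → β ≼ r + s → β ≼ suc w · r + s
              grow 0≤r q = ≤-trans q (x≤n·x (suc w) 0≤r ⊞ ≤-refl)
              case-∈ : Similar β (suc w · x + s) (suc w · y + s)
              case-∈ with em {P = s ∈H} | total 0# s
              ... | yes s∈ | _ = inj₂ (inj₁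
                ( grow 0≤x (≤-by (x≥ ⊞ ≤-trans (-x≤∣x∣ s) (All.lookup u≥ s-listed s∈))
                    (solve 4 (λ b x u s → b :+ (x :+ u) ⊜ (x :+ s) :+ ((u :+ b) :- s)) refl β x u s))
                , grow 0≤y (≤-by (above H (+-closed β∈ (-‿closed s∈)) y∉ 0≤y)
                    (solve 3 (λ b y s → b :+ y ⊜ (y :+ s) :+ (b :- s)) refl β y s))))
              ... | no s∉ | inj₁ 0≤s = inj₂ (inj₁
                ( grow 0≤x (≤-respˡ-≈ (+-identityˡ β) (0≤x ⊞ above H β∈ s∉ 0≤s))
                , grow 0≤y (≤-respˡ-≈ (+-identityˡ β) (0≤y ⊞ above H β∈ s∉ 0≤s))))
              ... | no s∉ | inj₂ s≤0 = inj₂ (inj₂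
                ( ≤-by (above H (+-closed (·-closed H (suc w) x∈) β∈) -s∉ 0≤-s)
                    (solve 3 (λ x s b → (x :+ s) :- s ⊜ (⊖ b) :+ (x :+ b)) refl (suc w · x) s β)
                -- `lower` was called with `suc N`, not `N`: the spare copy of `y` absorbs `β`.
                , ≤-by (≤-trans (·-monoˡ {suc (suc w)} (ℕ.s≤s (ℕ.≤-trans (ℕ.m≤m+n _ _) p)) 0≤y)
                         (≤-respʳ-≈ (≤0⇒∣∣≈- s≤0) (All.lookup y≤ s-listed s∉))
                       ⊞ above H β∈ y∉ 0≤y)
                    (solve 4 (λ r s b y → (r :+ s) :+ ((⊖ s) :+ y) ⊜ (⊖ b) :+ ((y :+ r) :+ b))
                      refl (suc w · y) s β y)))
                where
                -s∉ : ¬ (- s ∈H)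
                -s∉ p = s∉ (resp (solve 1 (λ s → ⊖ (⊖ s) ⊜ s) refl s) (-‿closed p))
                0≤-s : 0# ≼ - s
                0≤-s = ≤-by s≤0 (solve 1 (λ s → 𝟎 :+ 𝟎 ⊜ (⊖ s) :+ s) refl s)

            similar : ∀ z → ‖ z ‖ ≤ N → Similar β (comb z (x ∷ ρ)) (comb z (y ∷ ρ))
            similar (+ zero ∷ z)   p = inj₁ refl
            similar (+ suc w ∷ z)  p = similar-suc w z p
            similar (-[1+ w ] ∷ z) p = Similar-resp (flip x) (flip y) (Similar-neg
              (similar-suc w (-ᶜ z) (≡.subst (λ l → suc w ℕ.+ l ≤ N) (≡.sym (‖-ᶜ‖ z)) p)))
              where
              flip : ∀ r → - (suc w · r + comb (-ᶜ z) ρ) ≈ - (suc w · r) + comb z ρ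
              flip r = trans (-‿cong (+-congˡ (comb-neg z ρ)))
                (solve 2 (λ u z → ⊖ (u :- z) ⊜ (⊖ u) :+ z) refl (suc w · r) (comb z ρ))

-- Multiples in subgroups and quotients

module _ {c ℓ₁ ℓ₂ s} {G : OrderedAbelianGroup c ℓ₁ ℓ₂} (S : ConvexSubgroup G s) where
  open OrderedAbelianGroup G using (_·_)

  subgroup-· : ∀ n x → proj₁ (OrderedAbelianGroup._·_ (subgroup G S) n x) ≡ n · proj₁ x
  subgroup-· zero    x = ≡.refl
  subgroup-· (suc n) x = ≡.cong (OrderedAbelianGroup._+_ G (proj₁ x)) (subgroup-· n x)

  quotient-· : ∀ n x → OrderedAbelianGroup._·_ (quotient G S) n x ≡ n · x
  quotient-· zero    x = ≡.refl
  quotient-· (suc n) x = ≡.cong (OrderedAbelianGroup._+_ G x) (quotient-· n x)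

-- The element `q` from the hypotheses on `H`

module Gaps {c ℓ₁ ℓ₂ h} (em : ∀ {a} → ExcludedMiddle a)
  (G : OrderedAbelianGroup c ℓ₁ ℓ₂) (H : ConvexSubgroup G h) (n : ℕ) {{_ : NonZero n}} where
  open OrderedAbelianGroup G renaming (_≤_ to infix 4 _≼_)
  open Linear G
  open ConvexSubgroup H

  -- The quotient has the carrier of G, so K serves as its own preimage.
  preimage : ∀ {k} → ConvexSubgroup (quotient G H) k → ConvexSubgroup G k
  preimage K = record
    { _∈H = _∈K ; 0∈ = 0∈K ; +-closed = +-closedK ; -‿closed = -‿closedK
    ; convex = λ x∈ z∈ x≤y y≤z → convexK x∈ z∈ (≤⇒≤/ x≤y) (≤⇒≤/ y≤z)
    }
    where
    open ConvexSubgroup K renaming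
      (_∈H to _∈K; 0∈ to 0∈K; +-closed to +-closedK; -‿closed to -‿closedK; convex to convexK; resp to respK)
    ≤⇒≤/ : ∀ {x y} → x ≼ y → _≤/_ G H x y
    ≤⇒≤/ {x} {y} p = 0# , 0∈ , ≤-respʳ-≈ (sym (+-identityʳ y)) p

  -- Approximability with `H` in place of `K`.
  Fills : Carrier → Set _
  Fills q = ∀ {x} → x ∈H → ∃[ y ] (y ∈H × x ≼ n · y × n · y ≼ x + q)

  Gap : Set _
  Gap = ∃[ q ] (q ∈H × 0# ≼ q × q ≉ 0# × Fills q)

  positive : ∀ {x} → x ≉ 0# → 0# ≼ x → ∀ n .{{_ : NonZero n}} → n · x ≉ 0#
  positive x≉0 0≤x n e = x≉0 (·-cancel-≈ n (trans e (sym (·-zero n))))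

  ∣∣≉0 : ∀ {x} → x ≉ 0# → ∣ x ∣ ≉ 0#
  ∣∣≉0 {x} x≉0 e = x≉0 (antisym (≤-respʳ-≈ e (x≤∣x∣ x))
    (≤-by (≤-respʳ-≈ e (-x≤∣x∣ x)) (solve 1 (λ x → 𝟎 :+ 𝟎 ⊜ x :- x) refl x)))

  module Archimedean {p} (p∈ : p ∈H) (0≤p : 0# ≼ p) where
    q : Carrier
    q = n · p

    -- Division with remainder: each subtraction of `q` from `x` adds `p` to `y`, until `x` is at
    -- most `q` and `q = n · p` itself serves.
    fill : ∀ m {x} → 0# ≼ x → x ≼ m · q → ∃[ y ] (y ∈H × x ≼ n · y × n · y ≼ x + q)
    fill zero    {x} 0≤x x≤0 = 0# , 0∈ , ≤-respʳ-≈ (sym (·-zero n)) x≤0 ,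
      ≤-respˡ-≈ (trans (+-identityˡ 0#) (sym (·-zero n))) (0≤x ⊞ 0≤· n 0≤p)
    fill (suc m) {x} 0≤x x≤ with total x q
    ... | inj₁ x≤q = p , p∈ , x≤q , ≤-respˡ-≈ (+-identityˡ q) (0≤x ⊞ ≤-refl)
    ... | inj₂ q≤x with fill m {x + - q}
      (≤-by q≤x (solve 2 (λ x q → 𝟎 :+ x ⊜ (x :- q) :+ q) refl x q))
      (≤-by x≤ (solve 3 (λ x q r → (x :- q) :+ (q :+ r) ⊜ r :+ x) refl x q (m · q)))
    ...   | y , y∈ , a , b = y + p , +-closed y∈ p∈ ,
      ≤-respʳ-≈ (sym (·-distrib-+ y p n))
        (≤-by a (solve 3 (λ x q r → x :+ r ⊜ (r :+ q) :+ (x :- q)) refl x q (n · y))) ,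
      ≤-respˡ-≈ (sym (·-distrib-+ y p n))
        (≤-by b (solve 3 (λ x q r → (r :+ q) :+ (x :- q :+ q) ⊜ (x :+ q) :+ r) refl x q (n · y)))

    -- A shift by `m · q`, which is `n` times `m · p`, makes `x` nonnegative and is undone at the
    -- end.
    fills : (∀ {x} → x ∈H → ∃[ m ] ∣ x ∣ ≼ m · p) → Fills q
    fills bounded {x} x∈ with bounded x∈
    ... | m , ∣x∣≤ with fill (m ℕ.+ m) {x + m · q}
      (≤-by (≤-trans (-x≤∣x∣ x) ∣x∣≤mq) (solve 2 (λ x r → 𝟎 :+ r ⊜ (x :+ r) :- x) refl x (m · q)))
      (≤-respʳ-≈ (sym (·-homo-+ q m m)) (≤-trans (x≤∣x∣ x) ∣x∣≤mq ⊞ ≤-refl))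
      where
      ∣x∣≤mq : ∣ x ∣ ≼ m · q
      ∣x∣≤mq = ≤-trans ∣x∣≤ (·-mono m (x≤n·x n 0≤p))
    ... | y , y∈ , a , b = y + - (m · p) , +-closed y∈ (-‿closed (·-closed H m p∈)) ,
      ≤-respʳ-≈ (sym eq) (≤-by a (solve 3 (λ x r t → x :+ t ⊜ (t :- r) :+ (x :+ r)) refl x (m · q) (n · y))) ,
      ≤-respˡ-≈ (sym eq) (≤-by b (solve 4 (λ x r t q → (t :- r) :+ (x :+ r :+ q) ⊜ (x :+ q) :+ t)
        refl x (m · q) (n · y) q))
      where
      eq : n · (y + - (m · p)) ≈ n · y + - (m · q)
      eq = trans (·-distrib-+ y _ n) (+-congˡ (trans (·-neg n (m · p)) (-‿cong (trans (·-assocˡ p n m)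
        (trans (reflexive (≡.cong (_· p) (ℕ.*-comm n m))) (sym (·-assocˡ p m n)))))))

  -- The least class consists of the elements of largest magnitude, so the multiples of a
  -- representative `a` in `H` bound all of `H`.
  gap-minimum : HasMinimum G (v[_∖0] G _∈H) → Gap
  gap-minimum (γ , (a , a∈ , a≉0 , j , _ , γ≤a , _) , least) =
    n · ∣ a ∣ , ·-closed H n (∣∣-closed H a∈) , 0≤· n (0≤∣x∣ a) ,
    positive (∣∣≉0 a≉0) (0≤∣x∣ a) n , Archimedean.fills (∣∣-closed H a∈) (0≤∣x∣ a) bounded
    where
    ∼-refl : ∀ x → _∼_ G x x
    ∼-refl x = 1 , ℕ.s≤s ℕ.z≤n , ≤-reflexive (sym (+-identityʳ _)) , ≤-reflexive (sym (+-identityʳ _))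
    bounded : ∀ {x} → x ∈H → ∃[ m ] ∣ x ∣ ≼ m · ∣ a ∣
    bounded {x} x∈ with em {P = x ≈ 0#}
    ... | yes x≈0 = 0 , ≤-reflexive (trans (0≤⇒∣∣≈ (≤-reflexive (sym x≈0))) x≈0)
    ... | no x≉0 with least x (x , x∈ , x≉0 , ∼-refl x)
    ...   | inj₁ ((x≤γ , _) , _)      = j , ≤-trans x≤γ γ≤a
    ...   | inj₂ (i , _ , _ , x≤γ) = i ℕ.* j , ≤-trans x≤γ (≤-respʳ-≈ (·-assocˡ _ i j) (·-mono i γ≤a))

  -- For `p` in `H` outside of `H′`, some `n · y` is congruent to `x + ∣ p ∣` modulo `H′`. The error
  -- is less than `∣ p ∣` on either side, so twice `∣ p ∣` works as `q`.
  gap-divisible : ∀ {h′} (H′ : ConvexSubgroup (subgroup G H) h′) → Proper (subgroup G H) H′ →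
                  Divisible (quotient (subgroup G H) H′) n → Gap
  gap-divisible H′ ((p , p∈) , p∉) divisible =
    ∣ p ∣ + ∣ p ∣ , +-closed (proj₂ a) (proj₂ a) ,
    ≤-respˡ-≈ (+-identityˡ 0#) (0≤∣x∣ p ⊞ 0≤∣x∣ p) ,
    (λ e → a∉ (ConvexSubgroup.resp H′ {0# , 0∈} {a} (sym (·-cancel-≈ 2
      (trans (+-congˡ (+-identityʳ _)) (trans e (sym (·-zero 2)))))) (ConvexSubgroup.0∈ H′))) ,
    fills
    where
    a : Σ[ x ∈ Carrier ] x ∈H
    a = ∣ p ∣ , ∣∣-closed H p∈
    a∉ : ¬ ConvexSubgroup._∈H H′ a
    a∉ = λ r → p∉ (ConvexSubgroup.convex H′ { - ∣ p ∣ , -‿closed (proj₂ a)} {p , p∈} {a}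
      (ConvexSubgroup.-‿closed H′ r) r
      (≤-by (-x≤∣x∣ p) (solve 2 (λ x a → (⊖ a) :+ a ⊜ x :- x) refl p ∣ p ∣)) (x≤∣x∣ p))
    fills : Fills (∣ p ∣ + ∣ p ∣)
    fills {x} x∈ with divisible (x + ∣ p ∣ , +-closed x∈ (proj₂ a))
    ... | (y , y∈) , d = y , y∈ ,
      ≤-by (≤-respˡ-≈ (-‿cong (+-congʳ ny≈)) (above H′ (ConvexSubgroup.-‿closed H′ d) a∉ (0≤∣x∣ p)))
        (solve 3 (λ x a r → x :+ a ⊜ r :- (r :- (x :+ a))) refl x ∣ p ∣ (n · y)) ,
      ≤-by (≤-respˡ-≈ (+-congʳ ny≈) (above H′ d a∉ (0≤∣x∣ p)))
        (solve 3 (λ x a r → r :+ a ⊜ (x :+ (a :+ a)) :+ (r :- (x :+ a))) refl x ∣ p ∣ (n · y))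
      where
      ny≈ : proj₁ (OrderedAbelianGroup._·_ (quotient (subgroup G H) H′) n (y , y∈)) ≈ n · y
      ny≈ = reflexive (≡.trans (≡.cong proj₁ (quotient-· H′ n (y , y∈))) (subgroup-· H n (y , y∈)))

  -- Divisibility modulo `H` yields `y` with `x - n · y` in `H`; this remainder is then approximated
  -- by some `n · z` within `H`.
  fills⇒approximable : ∀ {k q} (K : ConvexSubgroup (quotient G H) k) →
    (∀ {x} → x ∈H → ConvexSubgroup._∈H K x) → Divisible (subgroup (quotient G H) K) n → Fills q →
    ∀ {x} → ConvexSubgroup._∈H K x →
    ∃[ y ] (ConvexSubgroup._∈H K y × x ≼ n · y × n · y ≼ x + q)
  fills⇒approximable {q = q} K H⊆K divisible fills {x} x∈ with divisible (x , x∈)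
  ... | (y , y∈) , d with fills (-‿closed (resp (+-congʳ ny≈) d))
    where
    ny≈ : proj₁ (OrderedAbelianGroup._·_ (subgroup (quotient G H) K) n (y , y∈)) ≈ n · y
    ny≈ = reflexive (≡.trans (subgroup-· K n (y , y∈)) (quotient-· H n y))
  ...   | z , z∈ , a , b = y + z , ConvexSubgroup.+-closed K y∈ (H⊆K z∈) ,
    ≤-respʳ-≈ (sym (·-distrib-+ y z n))
      (≤-by a (solve 3 (λ x r t → x :+ t ⊜ (r :+ t) :- (r :- x)) refl x (n · y) (n · z))) ,
    ≤-respˡ-≈ (sym (·-distrib-+ y z n))
      (≤-by b (solve 4 (λ x r t q → (r :+ t) :+ ((⊖ (r :- x)) :+ q) ⊜ (x :+ q) :+ t)
        refl x (n · y) (n · z) q))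

  ¬-defines : ∀ {k} (K : ConvexSubgroup (quotient G H) k) →
    NonTrivial (subgroup (quotient G H) K) → Divisible (subgroup (quotient G H) K) n → Gap →
    ∀ {m} (φ : Formula (suc m)) → modulus (level φ) ∣ n → suc (coefficients (level φ)) ≤ n →
    ∀ params → ¬ (∀ x → x ∈H ⇔ (_⊨_ G (x ∷ params) φ))
  ¬-defines K ((g , g∈) , g≉0) divisible (q , q∈ , 0≤q , q≉0 , fills) φ M∣n N<n params defines =
    contradiction (separate {{modulus≢0 φ}} M∣n N<n params)
    where
    H⊆K : ∀ {x} → x ∈H → ConvexSubgroup._∈H K x
    H⊆K x∈ = ConvexSubgroup.resp K (resp (sym (+-identityˡ _)) (-‿closed x∈)) (ConvexSubgroup.0∈ K)
    g∉ : ¬ (g ∈H)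
    g∉ p = g≉0 (+-closed p (-‿closed 0∈))
    open Game em G (preimage K)
    approx : Approximable (H⊆K q∈) 0≤q q≉0 n
    approx = fills⇒approximable K H⊆K divisible fills
    separate = Separation.separate (H⊆K q∈) 0≤q q≉0 approx H q∈ g∈ g∉ (level φ)
    contradiction : ∃[ x ] ∃[ y ] (x ∈H × ¬ (y ∈H) ×
      Close (H⊆K q∈) 0≤q q≉0 (level φ) (x ∷ params) (y ∷ params)) → ⊥
    contradiction (x , y , x∈ , y∉ , close) = y∉ (Equivalence.from (defines y)
      (transfer (H⊆K q∈) 0≤q q≉0 approx φ M∣n close (Equivalence.to (defines x) x∈)))

-- Choice of `n` for a given formula

large-multiple : ∀ M N .{{_ : NonZero M}} → ∃[ n ] (2 ≤ n × M ∣ n × suc N ≤ n)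
large-multiple M N =
  M ℕ.* suc (suc N) , ℕ.≤-trans (ℕ.s≤s (ℕ.s≤s ℕ.z≤n)) (ℕ.m≤n*m (suc (suc N)) M) , m∣m*n _ ,
  ℕ.≤-trans (ℕ.n≤1+n _) (ℕ.m≤n*m (suc (suc N)) M)

corollary4p9 : (∀ {a} → ExcludedMiddle a) →
    ∀ {c ℓ₁ ℓ₂ h k h′} (G : OrderedAbelianGroup c ℓ₁ ℓ₂) (H : ConvexSubgroup G h) →
    Proper G H →
    (∀ (n : ℕ) → 2 ≤ n →
    (Σ[ K ∈ ConvexSubgroup (quotient G H) k ]
    (NonTrivial (subgroup (quotient G H) K) × Divisible (subgroup (quotient G H) K) n))
    ×
    (HasMinimum G (v[_∖0] G (ConvexSubgroup._∈H H))
    ⊎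
    (Σ[ H′ ∈ ConvexSubgroup (subgroup G H) h′ ]
    (Proper (subgroup G H) H′ × Divisible (quotient (subgroup G H) H′) n)))) →
    ¬ Definable G (ConvexSubgroup._∈H H)
corollary4p9 em G H _ hyp (_ , φ , params , defines)
  -- The defining formula dictates `n`: its modulus has to divide `n` for the moves of the game, and
  -- `n` has to exceed its coefficient bound for `lower`.
  with large-multiple (modulus (level φ)) (coefficients (level φ)) {{modulus≢0 φ}}
... | n , 2≤n , M∣n , N<n with hyp n 2≤n
...   | (K , nontrivial , divisible) , cases =
  ¬-defines K nontrivial divisible
    ([ gap-minimum , (λ (H′ , proper , H/H′-divisible) → gap-divisible H′ proper H/H′-divisible) ]′ cases)
    φ M∣n N<n params defines
  where open Gaps em G H n {{ℕ.>-nonZero (ℕ.<⇒≤ 2≤n)}}
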